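{- Let $G=C_{n_1}\cup C_{n_2}\cup \ldots \cup C_{n_k}$ ($k\ge 1$, each $n_i\ge 3$) be a vertex-disjoint union of $k$ cycles. Then the cycles $C_3$, $C_4$ and the graph $2C_3$ are not embeddable; the graphs $C_5$, $C_6$, $C_3 \cup C_4$, $C_3 \cup C_5$, $3C_3$ and $4C_3$ are uniquely embeddable; and every other such graph $G$ has at least two distinct embeddings.
   Context: All graphs are finite, simple (no loops or multiple edges). $G_1\cup G_2$ denotes the vertex-disjoint union, and $mH$ denotes the union of $m$ disjoint copies of $H$; $C_n$ is the cycle on $n$ vertices. An embedding (or packing) of a graph $G=(V,E)$ is a permutation $\sigma$ of $V$ such that whenever $xy\in E$, $\sigma(x)\sigma(y)\notin E$; $G$ is embeddable if it has an embedding. For an embedding $\sigma$, $\sigma(G)$ is the graph on $V$ with edge set $\{\sigma(x)\sigma(y): xy\in E\}$, and $G\oplus\sigma(G)$ is the graph on $V$ with edge set $E\cup E(\sigma(G))$ (a disjoint union of edge sets). Two embeddings $\sigma_1,\sigma_2$ are distinct if $G\oplus\sigma_1(G)$ and $G\oplus\sigma_2(G)$ are non-isomorphic. $G$ is uniquely embeddable if it is embeddable and all graphs $G\oplus\sigma(G)$, over all embeddings $\sigma$, are isomorphic. -}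

module Defs where

open import Data.Nat using (ℕ; zero; suc; _≤_)
open import Data.Fin using (Fin; toℕ)
open import Data.List using (List; length; lookup; []; _∷_)
open import Data.Product using (Σ; _×_; ∃; _,_)
open import Data.Sum using (_⊎_)
open import Relation.Nullary using (¬_)
open import Relation.Binary.PropositionalEquality using (_≡_; subst)
open import Function using (_↔_; Inverse)

-- A (simple) graph on vertex type V is given by its adjacency relation.
Rel : Set → Set₁
Rel V = V → V → Set

Step : (m : ℕ) → Fin m → Fin m → Set
Step m x y = (suc (toℕ x) ≡ toℕ y) ⊎ ((suc (toℕ x) ≡ m) × (toℕ y ≡ 0))

CycAdj : (m : ℕ) → Fin m → Fin m → Set
CycAdj m x y = Step m x y ⊎ Step m y x

CVert : List ℕ → Set
CVert ns = Σ (Fin (length ns)) (λ i → Fin (lookup ns i))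

CycUnion : (ns : List ℕ) → Rel (CVert ns)
CycUnion ns (i , a) (j , b) =
  Σ (i ≡ j) (λ e → CycAdj (lookup ns j) (subst (λ t → Fin (lookup ns t)) e a) b)

Perm : Set → Set
Perm V = V ↔ V

IsEmbedding : {V : Set} → Rel V → Perm V → Set
IsEmbedding E σ = ∀ x y → E x y → ¬ E (Inverse.to σ x) (Inverse.to σ y)

Embeddable : {V : Set} → Rel V → Set
Embeddable {V} E = Σ (Perm V) (IsEmbedding E)

Image : {V : Set} → Rel V → Perm V → Rel V
Image E σ u v = E (Inverse.from σ u) (Inverse.from σ v)

Oplus : {V : Set} → Rel V → Perm V → Rel V
Oplus E σ u v = E u v ⊎ Image E σ u v

Iso : {V : Set} → Rel V → Rel V → Set
Iso {V} E F = Σ (V ↔ V) (λ f →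
  ∀ u v → (E u v → F (Inverse.to f u) (Inverse.to f v))
        × (F (Inverse.to f u) (Inverse.to f v) → E u v))

UniquelyEmbeddable : {V : Set} → Rel V → Set
UniquelyEmbeddable {V} E =
  Embeddable E ×
  (∀ (σ₁ σ₂ : Perm V) → IsEmbedding E σ₁ → IsEmbedding E σ₂ →
     Iso (Oplus E σ₁) (Oplus E σ₂))

TwoDistinctEmbeddings : {V : Set} → Rel V → Set
TwoDistinctEmbeddings {V} E =
  Σ (Perm V) (λ σ₁ → Σ (Perm V) (λ σ₂ →
    IsEmbedding E σ₁ × IsEmbedding E σ₂ × ¬ Iso (Oplus E σ₁) (Oplus E σ₂)))

{-# OPTIONS --safe #-}
module Submission where

-- Packings are grown by two operations.  A vertex can subdivide an edge of each copy, which
-- lengthens a cycle by one, and a new cycle can be added next to an existing packing when its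
-- second copy trades two vertices with the old graph.  Both keep a connected packing connected.
-- If G splits into two embeddable parts, a connected embedding and one that keeps the parts
-- separate are distinct.  The remaining graphs are four infinite families, in which the presence
-- of a K₄ separates two embeddings (subdividing never creates a K₄, and it can be kept away from a
-- given one), and eight small graphs, where one embedding has a prism K₃ □ K₂ and another has none.
-- The unique embeddability of C₅, C₆, C₃ ∪ C₄ and C₃ ∪ C₅ is an exhaustive search modulo
-- automorphisms; for 3C₃ and 4C₃ a vertex is determined by its red and its blue triangle.

open import Defs
open import Data.Bool using (Bool; true; false; T; not; _∧_; _∨_)
open import Data.Bool.ListAction using (all)
open import Data.Bool.Properties using (∨-comm; T-∧; T-∨; T-not-≡; T-≡) renaming (_≟_ to _≟ᵇ_)
open import Data.Empty using (⊥; ⊥-elim)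
open import Data.Fin using (Fin; zero; suc; toℕ; fromℕ; fromℕ<; inject₁; opposite; punchOut; _≟_)
import Data.Fin.Properties as Finₚ
open import Data.Fin.Induction using (<-weakInduction)
open import Data.Fin.Relation.Unary.Top using (view; view-fromℕ; view-inject₁; ‵fromℕ; ‵inject₁)
open import Data.List using (List; length; lookup; []; _∷_; _++_; map; filterᵇ; concatMap; allFin; upTo;
  drop; take; reverse; replicate; cartesianProductWith)
open import Data.List.Membership.Propositional using (_∈_; lose)
open import Data.List.Membership.Propositional.Properties
  using (∈-map⁺; ∈-concatMap⁺; ∈-allFin; ∈-filter⁻; ∈-upTo⁺)
open import Data.List.Properties using (≡-dec; ++-identityʳ)
open import Data.List.Relation.Binary.Permutation.Propositional
  using (_↭_; refl; prep; swap; ↭-sym; ↭-trans) renaming (trans to transᵖ)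
open import Data.List.Relation.Binary.Permutation.Propositional.Properties
  using (shift; ++-comm; ++⁺ˡ; ↭-length)
open import Data.List.Relation.Unary.All as All using (All; []; _∷_)
import Data.List.Relation.Unary.All.Properties as Allₚ
open import Data.List.Relation.Unary.Any using (here; there)
open import Data.Maybe using (Maybe; just; nothing; fromMaybe) renaming (map to mapᵐ)
open import Data.Maybe.Properties using (just-injective)
open import Data.Nat using (ℕ; zero; suc; _+_; _∸_; _≤_; _<_; z≤n; s≤s; _<?_; _≡ᵇ_) renaming (_≟_ to _≟ℕ_)
open import Data.Nat.Induction using (<-wellFounded)
open import Data.Nat.ListAction using (sum)
import Data.Nat.Properties as ℕₚ
open import Data.Product using (Σ; _×_; ∃; _,_; proj₁; proj₂)
open import Data.Product.Properties.WithK using (,-injectiveʳ)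
open import Data.Sum using (_⊎_; inj₁; inj₂; [_,_]) renaming (map to map-⊎; swap to swap-⊎)
open import Data.Sum.Properties using () renaming (≡-dec to ⊎-≡-dec)
open import Data.Unit using (tt)
open import Function using (_↔_; Inverse; Equivalence; mk↔ₛ′; _∘_; id)
open import Function.Construct.Composition using (_↔-∘_)
open import Function.Construct.Identity using (↔-id)
open import Function.Construct.Symmetry using (↔-sym)
open import Induction.WellFounded using (Acc; acc)
open import Relation.Binary.Definitions using (DecidableEquality)
open import Relation.Binary.PropositionalEquality
  using (_≡_; _≢_; refl; sym; trans; cong; cong₂; subst; subst₂; ≢-sym; subst-injective; subst-sym-subst)
open import Relation.Nullary using (¬_; Dec; yes; no; does; contradiction)
open import Relation.Nullary.Decidable using (T?; map′; _×-dec_; _⊎-dec_; _→-dec_; ¬?)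
open Inverse using (to; from; strictlyInverseˡ; strictlyInverseʳ)

-- Graph isomorphisms and disjoint unions

-- Why just these families remain: a graph fails to split when every division into two parts leaves
-- one of the non-embeddable graphs C₃, C₄, 2C₃. Next to a cycle of length at least five the rest
-- must therefore be empty or one of these three, which gives four infinite families; without such a
-- cycle only finitely many graphs remain. Two long cycles always split. In the families both
-- embeddings must come from one operation that can be repeated without end, while the
-- distinguishing subgraph survives in one of them and is never created in the other. This dictates
-- how the subdivided edges are chosen. A further obstacle is C₅: its two copies fill K₅, so no two
-- vertices are left non-adjacent and a triangle cannot be added beside it by an exchange. Longer
-- cycles can, and C₃ ∪ C₅ is tabulated.

infix 4 _≅_
infixr 6 _⊕_
infixr 5 _∪_

record _≅_ {V W : Set} (E : Rel V) (F : Rel W) : Set where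
  constructor iso
  field
    bij    : V ↔ W
    pres   : ∀ {u v} → E u v → F (to bij u) (to bij v)
    pres⁻¹ : ∀ {x y} → F x y → E (from bij x) (from bij y)

open _≅_

reflects : {V W : Set} {E : Rel V} {F : Rel W} (i : E ≅ F) {u v : V} →
  F (to (bij i) u) (to (bij i) v) → E u v
reflects {E = E} i p =
  subst₂ E (strictlyInverseʳ (bij i) _) (strictlyInverseʳ (bij i) _) (pres⁻¹ i p)

≅-refl : {V : Set} {E : Rel V} → E ≅ E
≅-refl = iso (↔-id _) id id

≅-sym : {V W : Set} {E : Rel V} {F : Rel W} → E ≅ F → F ≅ E
≅-sym (iso b p q) = iso (↔-sym b) q p

≅-trans : {U V W : Set} {D : Rel U} {E : Rel V} {F : Rel W} → D ≅ E → E ≅ F → D ≅ F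
≅-trans (iso b p q) (iso b′ p′ q′) = iso (b′ ↔-∘ b) (p′ ∘ p) (q ∘ q′)

pullback : {V W : Set} (b : V ↔ W) (F : Rel W) → (λ u v → F (to b u) (to b v)) ≅ F
pullback b F = iso b id
  (subst₂ F (sym (strictlyInverseˡ b _)) (sym (strictlyInverseˡ b _)))

_⊕_ : {V W : Set} → Rel V → Rel W → Rel (V ⊎ W)
(E ⊕ F) (inj₁ u) (inj₁ v) = E u v
(E ⊕ F) (inj₂ x) (inj₂ y) = F x y
(E ⊕ F) (inj₁ _) (inj₂ _) = ⊥
(E ⊕ F) (inj₂ _) (inj₁ _) = ⊥

⊕-cong : {V V′ W W′ : Set} {E : Rel V} {E′ : Rel V′} {F : Rel W} {F′ : Rel W′} →
  E ≅ E′ → F ≅ F′ → (E ⊕ F) ≅ (E′ ⊕ F′)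
⊕-cong {E = E} {E′} {F} {F′} i j = iso
  (mk↔ₛ′ (map-⊎ (to (bij i)) (to (bij j))) (map-⊎ (from (bij i)) (from (bij j)))
    (λ { (inj₁ x) → cong inj₁ (strictlyInverseˡ (bij i) x)
       ; (inj₂ x) → cong inj₂ (strictlyInverseˡ (bij j) x) })
    (λ { (inj₁ x) → cong inj₁ (strictlyInverseʳ (bij i) x)
       ; (inj₂ x) → cong inj₂ (strictlyInverseʳ (bij j) x) }))
  (λ {u} {v} → p u v) (λ {x} {y} → q x y)
  where
  p : ∀ u v → (E ⊕ F) u v → (E′ ⊕ F′) (map-⊎ (to (bij i)) (to (bij j)) u) (map-⊎ (to (bij i)) (to (bij j)) v)
  p (inj₁ _) (inj₁ _) = pres i
  p (inj₂ _) (inj₂ _) = pres j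
  q : ∀ x y → (E′ ⊕ F′) x y →
    (E ⊕ F) (map-⊎ (from (bij i)) (from (bij j)) x) (map-⊎ (from (bij i)) (from (bij j)) y)
  q (inj₁ _) (inj₁ _) = pres⁻¹ i
  q (inj₂ _) (inj₂ _) = pres⁻¹ j

⊕-comm : {V W : Set} {E : Rel V} {F : Rel W} → (E ⊕ F) ≅ (F ⊕ E)
⊕-comm {E = E} {F} = iso
  (mk↔ₛ′ swap-⊎ swap-⊎
    (λ { (inj₁ _) → refl ; (inj₂ _) → refl }) (λ { (inj₁ _) → refl ; (inj₂ _) → refl }))
  (λ {u} {v} → p u v) (λ {x} {y} → q x y)
  where
  p : ∀ u v → (E ⊕ F) u v → (F ⊕ E) (swap-⊎ u) (swap-⊎ v)
  p (inj₁ _) (inj₁ _) = id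
  p (inj₂ _) (inj₂ _) = id
  q : ∀ u v → (F ⊕ E) u v → (E ⊕ F) (swap-⊎ u) (swap-⊎ v)
  q (inj₁ _) (inj₁ _) = id
  q (inj₂ _) (inj₂ _) = id

⊕-assoc : {U V W : Set} {D : Rel U} {E : Rel V} {F : Rel W} → ((D ⊕ E) ⊕ F) ≅ (D ⊕ (E ⊕ F))
⊕-assoc {U} {V} {W} {D} {E} {F} = iso
  (mk↔ₛ′ f g
    (λ { (inj₁ _) → refl ; (inj₂ (inj₁ _)) → refl ; (inj₂ (inj₂ _)) → refl })
    (λ { (inj₁ (inj₁ _)) → refl ; (inj₁ (inj₂ _)) → refl ; (inj₂ _) → refl }))
  (λ {u} {v} → p u v) (λ {x} {y} → q x y)
  where
  f : (U ⊎ V) ⊎ W → U ⊎ (V ⊎ W)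
  f (inj₁ (inj₁ u)) = inj₁ u
  f (inj₁ (inj₂ v)) = inj₂ (inj₁ v)
  f (inj₂ w) = inj₂ (inj₂ w)
  g : U ⊎ (V ⊎ W) → (U ⊎ V) ⊎ W
  g (inj₁ u) = inj₁ (inj₁ u)
  g (inj₂ (inj₁ v)) = inj₁ (inj₂ v)
  g (inj₂ (inj₂ w)) = inj₂ w
  p : ∀ u v → ((D ⊕ E) ⊕ F) u v → (D ⊕ (E ⊕ F)) (f u) (f v)
  p (inj₁ (inj₁ _)) (inj₁ (inj₁ _)) = id
  p (inj₁ (inj₂ _)) (inj₁ (inj₂ _)) = id
  p (inj₂ _) (inj₂ _) = id
  q : ∀ u v → (D ⊕ (E ⊕ F)) u v → ((D ⊕ E) ⊕ F) (g u) (g v)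
  q (inj₁ _) (inj₁ _) = id
  q (inj₂ (inj₁ _)) (inj₂ (inj₁ _)) = id
  q (inj₂ (inj₂ _)) (inj₂ (inj₂ _)) = id

union-[] : {V : Set} {E : Rel V} → (CycUnion [] ⊕ E) ≅ E
union-[] = iso
  (mk↔ₛ′ (λ { (inj₁ (() , _)) ; (inj₂ v) → v }) inj₂ (λ _ → refl) (λ { (inj₁ (() , _)) ; (inj₂ _) → refl }))
  (λ { {inj₁ (() , _)} ; {inj₂ _} {inj₁ (() , _)} ; {inj₂ _} {inj₂ _} → id }) id

union-∷ : ∀ n ns → CycUnion (n ∷ ns) ≅ (CycAdj n ⊕ CycUnion ns)
union-∷ n ns = iso
  (mk↔ₛ′ f g
    (λ { (inj₁ _) → refl ; (inj₂ _) → refl })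
    (λ { (zero , _) → refl ; (suc _ , _) → refl }))
  (λ {u} {v} → p u v) (λ {x} {y} → q x y)
  where
  f : CVert (n ∷ ns) → Fin n ⊎ CVert ns
  f (zero , a) = inj₁ a
  f (suc i , a) = inj₂ (i , a)
  g : Fin n ⊎ CVert ns → CVert (n ∷ ns)
  g (inj₁ a) = zero , a
  g (inj₂ (i , a)) = suc i , a
  p : ∀ u v → CycUnion (n ∷ ns) u v → (CycAdj n ⊕ CycUnion ns) (f u) (f v)
  p (zero , a) (zero , b) (refl , e) = e
  p (suc i , a) (suc .i , b) (refl , e) = refl , e
  q : ∀ u v → (CycAdj n ⊕ CycUnion ns) u v → CycUnion (n ∷ ns) (g u) (g v)
  q (inj₁ a) (inj₁ b) e = refl , e
  q (inj₂ (i , a)) (inj₂ (.i , b)) (refl , e) = refl , e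

union-cong-∷ : ∀ n {ms ns} → CycUnion ms ≅ CycUnion ns → CycUnion (n ∷ ms) ≅ CycUnion (n ∷ ns)
union-cong-∷ n i = ≅-trans (union-∷ n _) (≅-trans (⊕-cong ≅-refl i) (≅-sym (union-∷ n _)))

union-++ : ∀ ms ns → CycUnion (ms ++ ns) ≅ (CycUnion ms ⊕ CycUnion ns)
union-++ [] ns = ≅-sym union-[]
union-++ (m ∷ ms) ns =
  ≅-trans (union-∷ m (ms ++ ns))
  (≅-trans (⊕-cong ≅-refl (union-++ ms ns))
  (≅-trans (≅-sym ⊕-assoc) (⊕-cong (≅-sym (union-∷ m ms)) ≅-refl)))

union-↭ : ∀ {ms ns} → ms ↭ ns → CycUnion ms ≅ CycUnion ns
union-↭ refl = ≅-refl
union-↭ (prep n p) = union-cong-∷ n (union-↭ p)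
union-↭ {ms = _ ∷ _ ∷ ms} (swap m n p) =
  ≅-trans (exchange m n ms) (union-cong-∷ n (union-cong-∷ m (union-↭ p)))
  where
  exchange : ∀ m n ns → CycUnion (m ∷ n ∷ ns) ≅ CycUnion (n ∷ m ∷ ns)
  exchange m n ns =
    ≅-trans (union-++ (m ∷ n ∷ []) ns)
    (≅-trans (⊕-cong (pair m n) ≅-refl) (≅-sym (union-++ (n ∷ m ∷ []) ns)))
    where
    pair : ∀ m n → CycUnion (m ∷ n ∷ []) ≅ CycUnion (n ∷ m ∷ [])
    pair m n = ≅-trans (union-++ (m ∷ []) (n ∷ [])) (≅-trans ⊕-comm (≅-sym (union-++ (n ∷ []) (m ∷ []))))
union-↭ (transᵖ p q) = ≅-trans (union-↭ p) (union-↭ q)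

Irreflexive Symmetric : {V : Set} → Rel V → Set
Irreflexive E = ∀ u → ¬ E u u
Symmetric E = ∀ u v → E u v → E v u

module _ {V W : Set} {E : Rel V} {F : Rel W} where

  symmetric-≅ : E ≅ F → Symmetric E → Symmetric F
  symmetric-≅ i s x y f = reflects (≅-sym i) (s _ _ (pres⁻¹ i f))

  irreflexive-≅ : E ≅ F → Irreflexive E → Irreflexive F
  irreflexive-≅ i irr x f = irr _ (pres⁻¹ i f)

  ⊕-symmetric : Symmetric E → Symmetric F → Symmetric (E ⊕ F)
  ⊕-symmetric s t (inj₁ u) (inj₁ v) = s u v
  ⊕-symmetric s t (inj₂ u) (inj₂ v) = t u v

  ⊕-irreflexive : Irreflexive E → Irreflexive F → Irreflexive (E ⊕ F)
  ⊕-irreflexive i j (inj₁ u) = i u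
  ⊕-irreflexive i j (inj₂ v) = j v

adj-sym : ∀ {m} {i j : Fin m} → CycAdj m i j → CycAdj m j i
adj-sym = swap-⊎

adj-irrefl : ∀ {m} {i : Fin (2 + m)} → ¬ CycAdj (2 + m) i i
adj-irrefl (inj₁ (inj₁ p)) = ℕₚ.1+n≢n p
adj-irrefl (inj₁ (inj₂ (p , q))) rewrite q with () ← p
adj-irrefl (inj₂ (inj₁ p)) = ℕₚ.1+n≢n p
adj-irrefl (inj₂ (inj₂ (p , q))) rewrite q with () ← p

union-symmetric : ∀ ns → Symmetric (CycUnion ns)
union-symmetric ns (i , a) (.i , b) (refl , e) = refl , swap-⊎ e

union-irreflexive : ∀ {ns} → All (3 ≤_) ns → Irreflexive (CycUnion ns)
union-irreflexive {n ∷ ns} (s≤s (s≤s (s≤s _)) ∷ _) (zero , a) (refl , e) = adj-irrefl e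
union-irreflexive {n ∷ ns} (_ ∷ ps) (suc i , a) (refl , e) = union-irreflexive ps (i , a) (refl , e)

vertex-≟ : ∀ ns → DecidableEquality (CVert ns)
vertex-≟ ns (i , a) (j , b) with i ≟ j
... | no i≢j = no λ { refl → i≢j refl }
... | yes refl with a ≟ b
...   | yes refl = yes refl
...   | no a≢b = no λ { refl → a≢b refl }

_∪_ : {V : Set} → Rel V → Rel V → Rel V
(E ∪ F) u v = E u v ⊎ F u v

-- Packings

-- An embedding in symmetric form: neither copy is the reference one. Vertices can be added to `W`
-- and the two copies can trade roles without conjugating permutations; pulling back along `red`
-- recovers the permutation.
record Packing {V : Set} (E : Rel V) : Set₁ where
  field
    {W}      : Set
    {R B}    : Rel W
    red      : E ≅ R
    blue     : E ≅ B
    disjoint : ∀ {u v} → R u v → ¬ B u v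

  graph : Rel W
  graph = R ∪ B

open Packing

module _ {V : Set} {E : Rel V} where

  packing-≅ : {V′ : Set} {E′ : Rel V′} → E ≅ E′ → Packing E → Packing E′
  packing-≅ i p = record
    { red = ≅-trans (≅-sym i) (red p) ; blue = ≅-trans (≅-sym i) (blue p) ; disjoint = disjoint p }

  packing→perm : Packing E → Perm V
  packing→perm p = ↔-sym (bij (red p)) ↔-∘ bij (blue p)

  packing→embedding : (p : Packing E) → IsEmbedding E (packing→perm p)
  packing→embedding p x y e f = disjoint p
    (subst₂ (R p) (strictlyInverseˡ (bij (red p)) _) (strictlyInverseˡ (bij (red p)) _) (pres (red p) f))
    (pres (blue p) e)

  oplus-packing : (p : Packing E) → Oplus E (packing→perm p) ≅ graph p
  oplus-packing p = iso (bij r)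
    [ inj₁ ∘ pres r
    , (λ e → inj₂ (subst₂ (B p) (strictlyInverseˡ (bij b) _) (strictlyInverseˡ (bij b) _) (pres b e))) ]
    [ inj₁ ∘ pres⁻¹ r
    , (λ e → inj₂ (subst₂ E (cong (from (bij b)) (sym (strictlyInverseˡ (bij r) _)))
                            (cong (from (bij b)) (sym (strictlyInverseˡ (bij r) _))) (pres⁻¹ b e))) ]
    where
    r = red p
    b = blue p

  embedding→packing : (σ : Perm V) → IsEmbedding E σ → Packing E
  embedding→packing σ emb = record
    { R = E
    ; B = Image E σ
    ; red = ≅-refl
    ; blue = ≅-sym (pullback (↔-sym σ) E)
    ; disjoint = λ {u} {v} e f → emb _ _ f
        (subst₂ E (sym (strictlyInverseˡ σ u)) (sym (strictlyInverseˡ σ v)) e) }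

  toIso : {F : Rel V} → E ≅ F → Iso E F
  toIso i = bij i , λ u v → pres i , reflects i

  fromIso : {F : Rel V} → Iso E F → E ≅ F
  fromIso {F} (b , h) = iso b (proj₁ (h _ _)) (λ {x} {y} e → proj₂ (h _ _)
    (subst₂ F (sym (strictlyInverseˡ b x)) (sym (strictlyInverseˡ b y)) e))

GraphProperty : Set₁
GraphProperty = {V : Set} → Rel V → Set

Invariant : GraphProperty → Set₁
Invariant P = ∀ {V W : Set} {E : Rel V} {F : Rel W} → E ≅ F → P E → P F

twoDistinct : (P : GraphProperty) → Invariant P → {V : Set} {E : Rel V} (p q : Packing E) →
  P (graph p) → ¬ P (graph q) → TwoDistinctEmbeddings E
twoDistinct P inv p q Pp ¬Pq =
  packing→perm p , packing→perm q , packing→embedding p , packing→embedding q ,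
  λ i → ¬Pq (inv (≅-trans (≅-sym (oplus-packing p)) (≅-trans (fromIso i) (oplus-packing q))) Pp)

twoDistinct-≅ : {V W : Set} {E : Rel V} {F : Rel W} → E ≅ F →
  TwoDistinctEmbeddings E → TwoDistinctEmbeddings F
twoDistinct-≅ {E = E} {F} i (σ , τ , eσ , eτ , ¬iso) =
  -- The separating invariant is isomorphism with `Oplus E σ` itself; transporting a packing leaves
  -- its underlying graph unchanged.
  twoDistinct P (λ j k → ≅-trans k j) p q ≅-refl (¬iso ∘ toIso)
  where
  p = packing-≅ i (embedding→packing σ eσ)
  q = packing-≅ i (embedding→packing τ eτ)
  P : GraphProperty
  P D = Oplus E σ ≅ D

embeddable-≅ : {V W : Set} {E : Rel V} {F : Rel W} → E ≅ F → Embeddable E → Embeddable F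
embeddable-≅ i (σ , eσ) = packing→perm p , packing→embedding p
  where p = packing-≅ i (embedding→packing σ eσ)

uniquelyEmbeddable-≅ : {V W : Set} {E : Rel V} {F : Rel W} → E ≅ F →
  UniquelyEmbeddable E → UniquelyEmbeddable F
uniquelyEmbeddable-≅ {E = E} {F} i (e , u) = embeddable-≅ i e , λ σ τ eσ eτ →
  let p = packing-≅ (≅-sym i) (embedding→packing σ eσ)
      q = packing-≅ (≅-sym i) (embedding→packing τ eτ)
  in toIso (≅-trans (≅-sym (oplus-packing p))
       (≅-trans (fromIso (u (packing→perm p) (packing→perm q) (packing→embedding p) (packing→embedding q)))
         (oplus-packing q)))

-- Connectedness, and the addition of a cycle

-- Connectedness without paths: no cut of the vertex set is respected by all edges. In this form a
-- change of the graph only has to be answered by equalities between values of `f`.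
Connected : GraphProperty
Connected {V} E = (f : V → Bool) → (∀ u v → E u v → f u ≡ f v) → ∀ u v → f u ≡ f v

connected-invariant : Invariant Connected
connected-invariant i c f h x y =
  subst₂ (λ u v → f u ≡ f v) (strictlyInverseˡ (bij i) x) (strictlyInverseˡ (bij i) y)
    (c (f ∘ to (bij i)) (λ u v e → h _ _ (pres i e)) (from (bij i) x) (from (bij i) y))

connected-cycle : ∀ {m} → Connected (CycAdj (suc m))
connected-cycle f h u v = trans (root u) (sym (root v))
  where
  root : ∀ k → f k ≡ f zero
  root = <-weakInduction (λ k → f k ≡ f zero) refl
    (λ i e → trans (sym (h _ _ (inj₁ (inj₁ (cong suc (Finₚ.toℕ-inject₁ i)))))) e)

_⊎-packing_ : {V V′ : Set} {E : Rel V} {E′ : Rel V′} → Packing E → Packing E′ → Packing (E ⊕ E′)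
_⊎-packing_ p q = record
  { red = ⊕-cong (red p) (red q) ; blue = ⊕-cong (blue p) (blue q)
  ; disjoint = λ {u} {v} → d u v }
  where
  d : ∀ u v → (R p ⊕ R q) u v → ¬ (B p ⊕ B q) u v
  d (inj₁ _) (inj₁ _) = disjoint p
  d (inj₂ _) (inj₂ _) = disjoint q

⊎-packing-disconnected : {V V′ : Set} {E : Rel V} {E′ : Rel V′} (p : Packing E) (q : Packing E′) →
  V → V′ → ¬ Connected (graph (p ⊎-packing q))
⊎-packing-disconnected p q v v′ c =
  contradiction (c side same (inj₁ (to (bij (red p)) v)) (inj₂ (to (bij (red q)) v′))) λ ()
  where
  side : W p ⊎ W q → Bool
  side = [ (λ _ → true) , (λ _ → false) ]
  same : ∀ x y → graph (p ⊎-packing q) x y → side x ≡ side y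
  same (inj₁ _) (inj₁ _) _ = refl
  same (inj₂ _) (inj₂ _) _ = refl
  same (inj₁ _) (inj₂ _) (inj₁ ())
  same (inj₁ _) (inj₂ _) (inj₂ ())
  same (inj₂ _) (inj₁ _) (inj₁ ())
  same (inj₂ _) (inj₁ _) (inj₂ ())

-- The place where a triangle can be attached. Both directions are recorded since the relations of a
-- packing carry no symmetry assumption.
record NonAdjacentPair {V : Set} (E : Rel V) : Set where
  constructor nonAdjacentPair
  field
    {x y} : V
    x≢y   : x ≢ y
    ¬xy   : ¬ E x y
    ¬yx   : ¬ E y x

≟-transport : {V W : Set} → V ↔ W → DecidableEquality V → DecidableEquality W
≟-transport b _≟ⱽ_ x y with from b x ≟ⱽ from b y
... | yes e = yes (trans (sym (strictlyInverseˡ b x)) (trans (cong (to b) e) (strictlyInverseˡ b y)))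
... | no ne = no (ne ∘ cong (from b))

-- The new cycle joins the red graph as it is.  Its blue copy trades the places of s and t
-- with those of two old vertices x and y, so that red and blue edges can meet only on
-- {x, y} or {s, t}.
module AddCycle {V : Set} {E : Rel V} (p : Packing E) (_≟ⱽ_ : DecidableEquality (W p))
  {x y : W p} (x≢y : x ≢ y) {m : ℕ} {s t : Fin (2 + m)} (s≢t : s ≢ t)
  -- After the exchange the blue copy of an edge st lies on xy, and a blue edge xy lies on st.
  -- Either clashes with a red edge unless one of the two pairs is free of edges.
  (safe : ¬ CycAdj (2 + m) s t ⊎ (¬ graph p x y × ¬ graph p y x))
  -- A cycle edge missing both s and t would stay in place and be both red and blue. Two vertices
  -- cover at most four edges of a cycle, so only C₃ and C₄ can be added directly; longer cycles are
  -- grown from C₄.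
  (cover : ∀ {i j} → CycAdj (2 + m) i j → (i ≡ s ⊎ i ≡ t) ⊎ (j ≡ s ⊎ j ≡ t)) where

  C = CycAdj (2 + m)
  Z = W p ⊎ Fin (2 + m)

  -- The involution is given by its graph: later proofs distinguish six kinds of vertices instead of
  -- unfolding the equality tests.
  data Exchange : Z → Z → Set where
    x↦s : Exchange (inj₁ x) (inj₂ s)
    y↦t : Exchange (inj₁ y) (inj₂ t)
    s↦x : Exchange (inj₂ s) (inj₁ x)
    t↦y : Exchange (inj₂ t) (inj₁ y)
    old : ∀ {w} → w ≢ x → w ≢ y → Exchange (inj₁ w) (inj₁ w)
    new : ∀ {k} → k ≢ s → k ≢ t → Exchange (inj₂ k) (inj₂ k)

  exchange : ∀ z → ∃ (Exchange z)
  exchange (inj₁ w) with w ≟ⱽ x | w ≟ⱽ y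
  ... | yes refl | _        = _ , x↦s
  ... | no _     | yes refl = _ , y↦t
  ... | no n     | no n′    = _ , old n n′
  exchange (inj₂ k) with k ≟ s | k ≟ t
  ... | yes refl | _        = _ , s↦x
  ... | no _     | yes refl = _ , t↦y
  ... | no n     | no n′    = _ , new n n′

  exchange-sym : ∀ {z z′} → Exchange z z′ → Exchange z′ z
  exchange-sym x↦s = s↦x
  exchange-sym y↦t = t↦y
  exchange-sym s↦x = x↦s
  exchange-sym t↦y = y↦t
  exchange-sym (old n n′) = old n n′
  exchange-sym (new n n′) = new n n′

  exchange-functional : ∀ {z z′ z″} → Exchange z z′ → Exchange z z″ → z′ ≡ z″
  exchange-functional x↦s x↦s = refl
  exchange-functional x↦s y↦t = contradiction refl x≢y
  exchange-functional x↦s (old n _) = contradiction refl n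
  exchange-functional y↦t x↦s = contradiction refl x≢y
  exchange-functional y↦t y↦t = refl
  exchange-functional y↦t (old _ n) = contradiction refl n
  exchange-functional s↦x s↦x = refl
  exchange-functional s↦x t↦y = contradiction refl s≢t
  exchange-functional s↦x (new n _) = contradiction refl n
  exchange-functional t↦y s↦x = contradiction refl s≢t
  exchange-functional t↦y t↦y = refl
  exchange-functional t↦y (new _ n) = contradiction refl n
  exchange-functional (old n _) x↦s = contradiction refl n
  exchange-functional (old _ n) y↦t = contradiction refl n
  exchange-functional (old _ _) (old _ _) = refl
  exchange-functional (new n _) s↦x = contradiction refl n
  exchange-functional (new _ n) t↦y = contradiction refl n
  exchange-functional (new _ _) (new _ _) = refl

  τ : Z → Z
  τ z = proj₁ (exchange z)

  τ-def : ∀ {z z′} → Exchange z z′ → τ z ≡ z′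
  τ-def {z} = exchange-functional (proj₂ (exchange z))

  τ↔ : Z ↔ Z
  τ↔ = mk↔ₛ′ τ τ invol invol
    where
    invol : ∀ z → τ (τ z) ≡ z
    invol z = τ-def (exchange-sym (proj₂ (exchange z)))

  blue′ : Rel Z
  blue′ z z′ = (B p ⊕ C) (τ z) (τ z′)

  separate : ∀ {z z′ u u′} → Exchange z u → Exchange z′ u′ → (R p ⊕ C) z z′ → ¬ (B p ⊕ C) u u′
  separate x↦s x↦s _ e = adj-irrefl e
  separate x↦s y↦t e e′ = [ (λ ¬st → ¬st e′) , (λ ¬xy → proj₁ ¬xy (inj₁ e)) ] safe
  separate y↦t x↦s e e′ = [ (λ ¬st → ¬st (adj-sym e′)) , (λ ¬xy → proj₂ ¬xy (inj₁ e)) ] safe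
  separate y↦t y↦t _ e = adj-irrefl e
  separate s↦x s↦x e _ = adj-irrefl e
  separate s↦x t↦y e e′ = [ (λ ¬st → ¬st e) , (λ ¬xy → proj₁ ¬xy (inj₂ e′)) ] safe
  separate t↦y s↦x e e′ = [ (λ ¬st → ¬st (adj-sym e)) , (λ ¬xy → proj₂ ¬xy (inj₂ e′)) ] safe
  separate t↦y t↦y e _ = adj-irrefl e
  separate (old _ _) (old _ _) e e′ = disjoint p e e′
  separate (new n n′) (new o o′) e _ = [ [ n , n′ ] , [ o , o′ ] ] (cover e)
  separate s↦x (new _ _) _ ()
  separate t↦y (new _ _) _ ()
  separate (new _ _) s↦x _ ()
  separate (new _ _) t↦y _ ()
  separate x↦s (old _ _) _ ()
  separate y↦t (old _ _) _ ()
  separate (old _ _) x↦s _ ()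
  separate (old _ _) y↦t _ ()

  packing : Packing (E ⊕ C)
  packing = record
    { R = R p ⊕ C
    ; B = blue′
    ; red = ⊕-cong (red p) ≅-refl
    ; blue = ≅-trans (⊕-cong (blue p) ≅-refl) (≅-sym (pullback τ↔ (B p ⊕ C)))
    ; disjoint = λ {z} {z′} → separate (proj₂ (exchange z)) (proj₂ (exchange z′)) }

  -- The vertices x and s trade places, so they lie on different sides in the red as well as in the
  -- blue copy. This supplies the pair for the next triangle.
  newPair : NonAdjacentPair (graph packing)
  newPair = nonAdjacentPair {x = inj₁ x} {inj₂ s} (λ ())
    [ (λ ()) , subst₂ (λ a b → ¬ (B p ⊕ C) a b) (sym (τ-def x↦s)) (sym (τ-def s↦x)) (λ ()) ]
    [ (λ ()) , subst₂ (λ a b → ¬ (B p ⊕ C) a b) (sym (τ-def s↦x)) (sym (τ-def x↦s)) (λ ()) ]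

  module _ {o : Fin (2 + m)} (so : C s o) (to : C t o) (o≢s : o ≢ s) (o≢t : o ≢ t) where

    -- The common neighbour o of s and t is not moved, so the blue cycle contains the path x, o, y
    -- and ties x and y to the red cycle. Hence `f` has the same value at a vertex and at its
    -- exchanged position, and every old edge, moved or not, is still respected.
    connected : Connected (graph p) → Connected (graph packing)
    connected c f h = λ u v → trans (root u) (sym (root v))
      where
      cyc : ∀ i j → f (inj₂ i) ≡ f (inj₂ j)
      cyc = connected-cycle (f ∘ inj₂) (λ i j e → h _ _ (inj₁ e))
      blue-edge : ∀ {z z′ u u′} → Exchange z u → Exchange z′ u′ → (B p ⊕ C) u u′ → f z ≡ f z′
      blue-edge ez ez′ e =
        h _ _ (inj₂ (subst₂ (B p ⊕ C) (sym (τ-def ez)) (sym (τ-def ez′)) e))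
      xo : f (inj₁ x) ≡ f (inj₂ o)
      xo = blue-edge x↦s (new o≢s o≢t) so
      yo : f (inj₁ y) ≡ f (inj₂ o)
      yo = blue-edge y↦t (new o≢s o≢t) to
      same : ∀ {z z′} → Exchange z z′ → f z ≡ f z′
      same x↦s = trans xo (cyc _ _)
      same y↦t = trans yo (cyc _ _)
      same s↦x = sym (trans xo (cyc _ _))
      same t↦y = sym (trans yo (cyc _ _))
      same (old _ _) = refl
      same (new _ _) = refl
      olds : ∀ u v → f (inj₁ u) ≡ f (inj₁ v)
      olds = c (f ∘ inj₁) λ
        { u v (inj₁ e) → h _ _ (inj₁ e)
        ; u v (inj₂ e) →
            let eu = proj₂ (exchange (inj₁ u)) ; ev = proj₂ (exchange (inj₁ v))
            in trans (same eu) (trans (blue-edge (exchange-sym eu) (exchange-sym ev) e) (sym (same ev))) }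
      root : ∀ z → f z ≡ f (inj₂ o)
      root (inj₁ w) = trans (olds w x) xo
      root (inj₂ k) = cyc k o

-- Subdivision of an edge

lastEdge : ∀ {m} → Step (suc m) (fromℕ m) zero
lastEdge {m} = inj₂ (cong suc (Finₚ.toℕ-fromℕ m) , refl)

module Insertion {W : Set} (a b : W) where

  Ends : Rel W
  Ends u v = (u ≡ a × v ≡ b) ⊎ (u ≡ b × v ≡ a)

  Insert : Rel W → Rel (Maybe W)
  Insert R (just u) (just v) = R u v × ¬ Ends u v
  Insert R nothing  (just v) = v ≡ a ⊎ v ≡ b
  Insert R (just u) nothing  = u ≡ a ⊎ u ≡ b
  Insert R nothing  nothing  = ⊥

open Insertion using (Insert; Ends)

insert-cong : {V W : Set} {E : Rel V} {F : Rel W} {a b : V} (i : E ≅ F) →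
  Insert a b E ≅ Insert (to (bij i) a) (to (bij i) b) F
insert-cong {V} {W} {E} {F} {a} {b} i = iso
  (mk↔ₛ′ f g
    (λ { nothing → refl ; (just w) → cong just (strictlyInverseˡ (bij i) w) })
    (λ { nothing → refl ; (just v) → cong just (strictlyInverseʳ (bij i) v) }))
  (λ {u} {v} → p u v) (λ {x} {y} → q x y)
  where
  f : Maybe V → Maybe W
  f nothing = nothing
  f (just v) = just (to (bij i) v)
  g : Maybe W → Maybe V
  g nothing = nothing
  g (just w) = just (from (bij i) w)
  inj : ∀ {u v} → to (bij i) u ≡ to (bij i) v → u ≡ v
  inj {u} {v} e = trans (sym (strictlyInverseʳ (bij i) u))
    (trans (cong (from (bij i)) e) (strictlyInverseʳ (bij i) v))
  flip′ : ∀ {x u} → x ≡ to (bij i) u → from (bij i) x ≡ u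
  flip′ refl = strictlyInverseʳ (bij i) _
  flop : ∀ {x u} → from (bij i) x ≡ u → x ≡ to (bij i) u
  flop refl = sym (strictlyInverseˡ (bij i) _)
  p : ∀ u v → Insert a b E u v → Insert (to (bij i) a) (to (bij i) b) F (f u) (f v)
  p (just u) (just v) (e , ne) = pres i e ,
    λ { (inj₁ (k , l)) → ne (inj₁ (inj k , inj l)) ; (inj₂ (k , l)) → ne (inj₂ (inj k , inj l)) }
  p nothing (just v) = map-⊎ (cong (to (bij i))) (cong (to (bij i)))
  p (just u) nothing = map-⊎ (cong (to (bij i))) (cong (to (bij i)))
  q : ∀ u v → Insert (to (bij i) a) (to (bij i) b) F u v → Insert a b E (g u) (g v)
  q (just u) (just v) (e , ne) = pres⁻¹ i e ,
    λ { (inj₁ (k , l)) → ne (inj₁ (flop k , flop l)) ; (inj₂ (k , l)) → ne (inj₂ (flop k , flop l)) }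
  q nothing (just v) = map-⊎ flip′ flip′
  q (just u) nothing = map-⊎ flip′ flip′

module _ {n : ℕ} {X : Set} (S : Rel X) where

  private
    m = 3 + n
    V = Fin m ⊎ X
    V⁺ = Fin (suc m) ⊎ X
    E = CycAdj m ⊕ S
    E⁺ = CycAdj (suc m) ⊕ S
    a b : V
    a = inj₁ (fromℕ (2 + n))
    b = inj₁ zero

  grow-to : V⁺ → Maybe V
  grow-to (inj₁ k) with view k
  ... | ‵fromℕ     = nothing
  ... | ‵inject₁ j = just (inj₁ j)
  grow-to (inj₂ x) = just (inj₂ x)

  private
    f = grow-to

    g : Maybe V → V⁺
    g nothing = inj₁ (fromℕ m)
    g (just (inj₁ j)) = inj₁ (inject₁ j)
    g (just (inj₂ x)) = inj₂ x

    fg : ∀ z → f (g z) ≡ z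
    fg nothing rewrite view-fromℕ m = refl
    fg (just (inj₁ j)) rewrite view-inject₁ j = refl
    fg (just (inj₂ x)) = refl

    gf : ∀ z → g (f z) ≡ z
    gf (inj₁ k) with view k
    ... | ‵fromℕ     = refl
    ... | ‵inject₁ j = refl
    gf (inj₂ x) = refl

    step⁻ : ∀ {i j : Fin m} → Step (suc m) (inject₁ i) (inject₁ j) → suc (toℕ i) ≡ toℕ j
    step⁻ {i} {j} (inj₁ e) rewrite Finₚ.toℕ-inject₁ i | Finₚ.toℕ-inject₁ j = e
    step⁻ {i} (inj₂ (e , _)) rewrite Finₚ.toℕ-inject₁ i =
      contradiction (ℕₚ.suc-injective e) (ℕₚ.<⇒≢ (Finₚ.toℕ<n i))

    step⁺ : ∀ {i j : Fin m} → Step m i j → ¬ (i ≡ fromℕ (2 + n) × j ≡ zero) →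
      Step (suc m) (inject₁ i) (inject₁ j)
    step⁺ {i} {j} (inj₁ e) _ rewrite Finₚ.toℕ-inject₁ i | Finₚ.toℕ-inject₁ j = inj₁ e
    step⁺ (inj₂ (e , e′)) ne = contradiction
      (Finₚ.toℕ-injective (trans (ℕₚ.suc-injective e) (sym (Finₚ.toℕ-fromℕ _))) , Finₚ.toℕ-injective e′) ne

    notEnds : ∀ {i j : Fin m} → suc (toℕ i) ≡ toℕ j → ¬ Ends a b (inj₁ i) (inj₁ j)
    notEnds () (inj₁ (_ , refl))
    notEnds e (inj₂ (refl , refl)) with () ← trans e (Finₚ.toℕ-fromℕ _)

    ends-swap : ∀ {u v} → Ends a b u v → Ends a b v u
    ends-swap (inj₁ (e , e′)) = inj₂ (e′ , e)
    ends-swap (inj₂ (e , e′)) = inj₁ (e′ , e)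

    from-last : ∀ {j : Fin m} → CycAdj (suc m) (fromℕ m) (inject₁ j) → inj₁ j ≡ a ⊎ inj₁ j ≡ b
    from-last {j} (inj₁ (inj₁ e)) rewrite Finₚ.toℕ-inject₁ j | Finₚ.toℕ-fromℕ m =
      contradiction (sym e) (ℕₚ.<⇒≢ (ℕₚ.m<n⇒m<1+n (Finₚ.toℕ<n j)))
    from-last {j} (inj₁ (inj₂ (_ , e))) rewrite Finₚ.toℕ-inject₁ j =
      inj₂ (cong inj₁ (Finₚ.toℕ-injective e))
    from-last {j} (inj₂ (inj₁ e)) rewrite Finₚ.toℕ-inject₁ j | Finₚ.toℕ-fromℕ n =
      inj₁ (cong inj₁ (Finₚ.toℕ-injective (trans (ℕₚ.suc-injective e) (sym (Finₚ.toℕ-fromℕ _)))))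
    from-last (inj₂ (inj₂ (_ , ())))

    to-last : ∀ {j : Fin m} → inj₁ j ≡ a ⊎ inj₁ j ≡ b → CycAdj (suc m) (fromℕ m) (inject₁ j)
    to-last (inj₁ refl) = inj₂ (inj₁ (cong suc (Finₚ.toℕ-inject₁ _)))
    to-last (inj₂ refl) = inj₁ lastEdge

    p : ∀ u v → E⁺ u v → Insert a b E (f u) (f v)
    p (inj₁ k) (inj₁ l) e with view k | view l
    p _ _ e | ‵fromℕ | ‵fromℕ = ⊥-elim (adj-irrefl e)
    p _ _ e | ‵fromℕ | ‵inject₁ j = from-last e
    p _ _ e | ‵inject₁ i | ‵fromℕ = from-last (adj-sym e)
    p _ _ (inj₁ e) | ‵inject₁ i | ‵inject₁ j = inj₁ (inj₁ (step⁻ e)) , notEnds (step⁻ e)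
    p _ _ (inj₂ e) | ‵inject₁ i | ‵inject₁ j = inj₂ (inj₁ (step⁻ e)) , notEnds (step⁻ e) ∘ ends-swap
    p (inj₁ k) (inj₂ x) ()
    p (inj₂ x) (inj₁ k) ()
    p (inj₂ x) (inj₂ y) e = e , λ { (inj₁ (() , _)) ; (inj₂ (() , _)) }

    q : ∀ u v → Insert a b E u v → E⁺ (g u) (g v)
    q nothing (just (inj₁ j)) e = to-last e
    q nothing (just (inj₂ x)) (inj₁ ())
    q nothing (just (inj₂ x)) (inj₂ ())
    q (just (inj₁ j)) nothing e = adj-sym (to-last e)
    q (just (inj₂ x)) nothing (inj₁ ())
    q (just (inj₂ x)) nothing (inj₂ ())
    q (just (inj₁ i)) (just (inj₁ j)) (inj₁ e , ne) =
      inj₁ (step⁺ e (λ { (refl , refl) → ne (inj₁ (refl , refl)) }))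
    q (just (inj₁ i)) (just (inj₁ j)) (inj₂ e , ne) =
      inj₂ (step⁺ e (λ { (refl , refl) → ne (inj₂ (refl , refl)) }))
    q (just (inj₂ x)) (just (inj₂ y)) (e , _) = e

  -- A cycle is lengthened at its closing edge: the new vertex gets the top index and all others
  -- keep theirs.
  grow : (CycAdj (4 + n) ⊕ S) ≅ Insert (inj₁ (fromℕ (2 + n))) (inj₁ zero) (CycAdj (3 + n) ⊕ S)
  grow = iso (mk↔ₛ′ f g fg gf) (λ {u} {v} → p u v) (λ {u} {v} → q u v)

-- Symmetries of a cycle, which bring a chosen edge into the closing position

rotate : ∀ {m} → Fin (suc m) → Fin (suc m)
rotate k with view k
... | ‵fromℕ     = zero
... | ‵inject₁ j = suc j

rotate-last : ∀ m → rotate (fromℕ m) ≡ zero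
rotate-last m rewrite view-fromℕ m = refl

rotate-inject₁ : ∀ {m} (j : Fin m) → rotate (inject₁ j) ≡ suc j
rotate-inject₁ j rewrite view-inject₁ j = refl

rotation : ∀ {m} → CycAdj (suc m) ≅ CycAdj (suc m)
rotation {m} = iso (mk↔ₛ′ rotate g fg gf)
  (map-⊎ p p) (λ {i} {j} → map-⊎ (q i j) (q j i))
  where
  g : Fin (suc m) → Fin (suc m)
  g zero = fromℕ m
  g (suc j) = inject₁ j
  fg : ∀ k → rotate (g k) ≡ k
  fg zero = rotate-last m
  fg (suc j) = rotate-inject₁ j
  gf : ∀ k → g (rotate k) ≡ k
  gf k with view k
  ... | ‵fromℕ     = refl
  ... | ‵inject₁ j = refl
  p : ∀ {i j} → Step (suc m) i j → Step (suc m) (rotate i) (rotate j)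
  p {i} {j} e with view i | view j
  p (inj₁ e) | ‵fromℕ | ‵fromℕ = contradiction e ℕₚ.1+n≢n
  p (inj₂ (e , e′)) | ‵fromℕ | ‵fromℕ rewrite e′ = inj₂ (e , refl)
  p (inj₁ e) | ‵fromℕ | ‵inject₁ j rewrite Finₚ.toℕ-inject₁ j | Finₚ.toℕ-fromℕ m =
    contradiction (sym e) (ℕₚ.<⇒≢ (ℕₚ.m<n⇒m<1+n (Finₚ.toℕ<n j)))
  p (inj₂ (e , e′)) | ‵fromℕ | ‵inject₁ j rewrite Finₚ.toℕ-inject₁ j = inj₁ (cong suc (sym e′))
  p (inj₁ e) | ‵inject₁ i | ‵fromℕ rewrite Finₚ.toℕ-inject₁ i | Finₚ.toℕ-fromℕ m =
    inj₂ (cong suc e , refl)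
  p (inj₂ (e , e′)) | ‵inject₁ i | ‵fromℕ rewrite Finₚ.toℕ-inject₁ i =
    contradiction (ℕₚ.suc-injective e) (ℕₚ.<⇒≢ (Finₚ.toℕ<n i))
  p (inj₁ e) | ‵inject₁ i | ‵inject₁ j rewrite Finₚ.toℕ-inject₁ i | Finₚ.toℕ-inject₁ j =
    inj₁ (cong suc e)
  p (inj₂ (e , e′)) | ‵inject₁ i | ‵inject₁ j rewrite Finₚ.toℕ-inject₁ i =
    contradiction (ℕₚ.suc-injective e) (ℕₚ.<⇒≢ (Finₚ.toℕ<n i))
  q : ∀ i j → Step (suc m) i j → Step (suc m) (g i) (g j)
  q zero (suc j) (inj₁ e) = inj₂ (cong suc (Finₚ.toℕ-fromℕ m) ,
    trans (Finₚ.toℕ-inject₁ j) (sym (ℕₚ.suc-injective e)))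
  q zero zero (inj₂ (refl , _)) = inj₂ (refl , refl)
  q (suc i) (suc j) (inj₁ e) = inj₁ (trans (cong suc (Finₚ.toℕ-inject₁ i))
    (trans (ℕₚ.suc-injective e) (sym (Finₚ.toℕ-inject₁ j))))
  q (suc i) zero (inj₂ (e , _)) = inj₁ (trans (cong suc (Finₚ.toℕ-inject₁ i))
    (trans (ℕₚ.suc-injective e) (sym (Finₚ.toℕ-fromℕ m))))

opposite-last : ∀ m → opposite (fromℕ m) ≡ zero
opposite-last m = Finₚ.opposite-involutive zero

reflection : ∀ {m} → CycAdj (suc m) ≅ CycAdj (suc m)
reflection {m} = iso (mk↔ₛ′ opposite opposite Finₚ.opposite-involutive Finₚ.opposite-involutive) adj adj
  where
  step : ∀ (i j : Fin (suc m)) → Step (suc m) i j → Step (suc m) (opposite j) (opposite i)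
  step i (suc j) (inj₁ e) = inj₁ (trans (cong suc (Finₚ.toℕ-inject₁ _)) (eq j i (ℕₚ.suc-injective e)))
    where
    eq : ∀ {m} (j : Fin m) (i : Fin (suc m)) → toℕ i ≡ toℕ j → suc (toℕ (opposite j)) ≡ toℕ (opposite i)
    eq zero zero _ = refl
    eq (suc j) (suc i) e = trans (cong suc (Finₚ.toℕ-inject₁ _))
      (trans (eq j i (ℕₚ.suc-injective e)) (sym (Finₚ.toℕ-inject₁ _)))
  step i zero (inj₂ (e , _)) = inj₂ (cong suc (Finₚ.toℕ-fromℕ m) ,
    trans (cong (toℕ ∘ opposite) (Finₚ.toℕ-injective (trans (ℕₚ.suc-injective e) (sym (Finₚ.toℕ-fromℕ m)))))
      (cong toℕ (opposite-last m)))
  adj : ∀ {i j} → CycAdj (suc m) i j → CycAdj (suc m) (opposite i) (opposite j)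
  adj {i} {j} (inj₁ e) = inj₂ (step i j e)
  adj {i} {j} (inj₂ e) = inj₁ (step j i e)

-- A packing in which the distinguished cycle can be lengthened: the new vertex subdivides the
-- edge ab of the first copy and the edge cd of the second one.  The same can then be done with
-- the two copies exchanged, the edge de taking the role of ab, and b, the new vertex, a
-- those of c, d, e.
record Growing (n : ℕ) {X : Set} (S : Rel X) : Set₁ where
  field
    {U}           : Set
    {R₁ R₂}       : Rel U
    h₁            : (CycAdj (3 + n) ⊕ S) ≅ R₁
    h₂            : (CycAdj (3 + n) ⊕ S) ≅ R₂
    apart         : ∀ {u v} → R₁ u v → ¬ R₂ u v
    {a b c d e}   : U
    a-def         : to (bij h₁) (inj₁ (fromℕ (2 + n))) ≡ a
    b-def         : to (bij h₁) (inj₁ zero) ≡ b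
    c-def         : to (bij h₂) (inj₁ (fromℕ (2 + n))) ≡ c
    d-def         : to (bij h₂) (inj₁ zero) ≡ d
    e-def         : to (bij h₂) (inj₁ (suc zero)) ≡ e
    -- That a, b differ from c, d keeps the red and blue edges at the new vertex apart. That they
    -- differ from e makes the condition reproduce itself: after a step it compares d, e with b, the
    -- new vertex and a.
    a≢c           : a ≢ c
    a≢d           : a ≢ d
    a≢e           : a ≢ e
    b≢c           : b ≢ c
    b≢d           : b ≢ d
    b≢e           : b ≢ e

  packing : Packing (CycAdj (3 + n) ⊕ S)
  packing = record { red = h₁ ; blue = h₂ ; disjoint = apart }

  ab : R₁ a b
  ab = subst₂ R₁ a-def b-def (pres h₁ (inj₁ lastEdge))

  cd : R₂ c d
  cd = subst₂ R₂ c-def d-def (pres h₂ (inj₁ lastEdge))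

private
  inserted : ∀ {n X} {S : Rel X} {W} {R : Rel W} (h : (CycAdj (3 + n) ⊕ S) ≅ R) {a b : W} →
    to (bij h) (inj₁ (fromℕ (2 + n))) ≡ a → to (bij h) (inj₁ zero) ≡ b →
    (CycAdj (4 + n) ⊕ S) ≅ Insert a b R
  inserted {S = S} h refl refl = ≅-trans (grow S) (insert-cong h)

  inserted-old : ∀ {n X} {S : Rel X} {W} {R : Rel W} (h : (CycAdj (3 + n) ⊕ S) ≅ R) {a b : W}
    (p : to (bij h) (inj₁ (fromℕ (2 + n))) ≡ a) (q : to (bij h) (inj₁ zero) ≡ b) (j : Fin (3 + n)) →
    to (bij (inserted h p q)) (inj₁ (inject₁ j)) ≡ just (to (bij h) (inj₁ j))
  inserted-old h refl refl j rewrite view-inject₁ j = refl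

  inserted-new : ∀ {n X} {S : Rel X} {W} {R : Rel W} (h : (CycAdj (3 + n) ⊕ S) ≅ R) {a b : W}
    (p : to (bij h) (inj₁ (fromℕ (2 + n))) ≡ a) (q : to (bij h) (inj₁ zero) ≡ b) →
    to (bij (inserted h p q)) (inj₁ (fromℕ (3 + n))) ≡ nothing
  inserted-new {n} h refl refl rewrite view-fromℕ n = refl

just-≢ : {A : Set} {x y : A} → x ≢ y → just x ≢ just y
just-≢ n = n ∘ just-injective

grow-step : ∀ {n X} {S : Rel X} → Growing n S → Growing (suc n) S
grow-step {n} {S = S} s = record
  { R₁ = Insert c d R₂
  ; R₂ = Insert a b R₁
  ; h₁ = ≅-trans (⊕-cong rotation ≅-refl) g₂
  -- Reflected, the lengthened first copy has b, the new vertex and a at its last, zeroth and first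
  -- index, so the next subdivision hits the edge from b to the new vertex. In `h₁` the rotation
  -- does the same for the edge de.
  ; h₂ = ≅-trans (⊕-cong reflection ≅-refl) g₁
  ; apart = λ {u} {v} → apart⁺ u v
  ; a = just d
  ; b = just e
  ; c = just b
  ; d = nothing
  ; e = just a
  ; a-def = trans (cong (to (bij g₂) ∘ inj₁) (rotate-last (3 + n)))
              (trans (inserted-old h₂ c-def d-def zero) (cong just d-def))
  ; b-def = trans (cong (to (bij g₂) ∘ inj₁) (rotate-inject₁ zero))
              (trans (inserted-old h₂ c-def d-def (suc zero)) (cong just e-def))
  ; c-def = trans (cong (to (bij g₁) ∘ inj₁) (opposite-last (3 + n)))
              (trans (inserted-old h₁ a-def b-def zero) (cong just b-def))
  ; d-def = inserted-new h₁ a-def b-def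
  ; e-def = trans (inserted-old h₁ a-def b-def (fromℕ (2 + n))) (cong just a-def)
  ; a≢c = just-≢ (≢-sym b≢d)
  ; a≢d = λ ()
  ; a≢e = just-≢ (≢-sym a≢d)
  ; b≢c = just-≢ (≢-sym b≢e)
  ; b≢d = λ ()
  ; b≢e = just-≢ (≢-sym a≢e)
  }
  where
  open Growing s
  g₁ : (CycAdj (4 + n) ⊕ S) ≅ Insert a b R₁
  g₁ = inserted h₁ a-def b-def
  g₂ : (CycAdj (4 + n) ⊕ S) ≅ Insert c d R₂
  g₂ = inserted h₂ c-def d-def
  both : ∀ {v} → v ≡ c ⊎ v ≡ d → ¬ (v ≡ a ⊎ v ≡ b)
  both (inj₁ refl) = [ ≢-sym a≢c , ≢-sym b≢c ]
  both (inj₂ refl) = [ ≢-sym a≢d , ≢-sym b≢d ]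
  apart⁺ : ∀ u v → Insert c d R₂ u v → ¬ Insert a b R₁ u v
  apart⁺ (just u) (just v) (r₂ , _) (r₁ , _) = apart r₁ r₂
  apart⁺ nothing (just v) = both
  apart⁺ (just u) nothing = both

module _ {n : ℕ} {X : Set} {S : Rel X} (s : Growing n S) where
  open Growing s using (U; a; b; c; d)

  private
    G = graph (Growing.packing s)
    G⁺ = graph (Growing.packing (grow-step s))

  -- An edge that disappears is replaced by a path through the new vertex. Deciding `Ends` tells the
  -- surviving edges from the subdivided ones.
  grow-connected : DecidableEquality U → Connected G → Connected G⁺
  grow-connected _≟ᵁ_ conn f h u v = trans (root u) (sym (root v))
    where
    decEnds : ∀ x y u v → Dec (Ends {U} x y u v)
    decEnds x y u v with u ≟ᵁ x | v ≟ᵁ y | u ≟ᵁ y | v ≟ᵁ x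
    ... | yes p | yes q | _ | _ = yes (inj₁ (p , q))
    ... | _ | _ | yes p | yes q = yes (inj₂ (p , q))
    ... | no p | _ | no q | _ = no [ p ∘ proj₁ , q ∘ proj₁ ]
    ... | no p | _ | _ | no q = no [ p ∘ proj₁ , q ∘ proj₂ ]
    ... | _ | no p | no q | _ = no [ p ∘ proj₂ , q ∘ proj₁ ]
    ... | _ | no p | _ | no q = no [ p ∘ proj₂ , q ∘ proj₂ ]
    subdivided : ∀ {x y u v} → f nothing ≡ f (just x) → f nothing ≡ f (just y) →
      Ends x y u v → f (just u) ≡ f (just v)
    subdivided p q (inj₁ (refl , refl)) = trans (sym p) q
    subdivided p q (inj₂ (refl , refl)) = trans (sym q) p
    edge : ∀ u v → G u v → f (just u) ≡ f (just v)
    edge u v (inj₁ r) with decEnds a b u v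
    ... | no ne = h _ _ (inj₂ (r , ne))
    ... | yes en = subdivided (h _ _ (inj₂ (inj₁ refl))) (h _ _ (inj₂ (inj₂ refl))) en
    edge u v (inj₂ r) with decEnds c d u v
    ... | no ne = h _ _ (inj₁ (r , ne))
    ... | yes en = subdivided (h _ _ (inj₁ (inj₁ refl))) (h _ _ (inj₁ (inj₂ refl))) en
    root : ∀ z → f z ≡ f (just a)
    root nothing = h _ _ (inj₂ (inj₁ refl))
    root (just w) = conn (f ∘ just) edge w a

  grow-nonAdjacentPair : NonAdjacentPair G → NonAdjacentPair G⁺
  grow-nonAdjacentPair (nonAdjacentPair x≢y ¬xy ¬yx) =
    nonAdjacentPair (just-≢ x≢y) (¬xy ∘ old) (¬yx ∘ old)
    where
    old : ∀ {u v} → G⁺ (just u) (just v) → G u v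
    old (inj₁ (r , _)) = inj₂ r
    old (inj₂ (r , _)) = inj₁ r

-- Complete subgraphs on four vertices under subdivision

record K₄ {V : Set} (E : Rel V) : Set where
  constructor k₄
  field
    {p q r s} : V
    pq : E p q
    pr : E p r
    ps : E p s
    qr : E q r
    qs : E q s
    rs : E r s

  Avoids : V → Set
  Avoids x = x ≢ p × x ≢ q × x ≢ r × x ≢ s

k₄-map : {V W : Set} {E : Rel V} {F : Rel W} (f : V → W) →
  (∀ {u v} → E u v → F (f u) (f v)) → K₄ E → K₄ F
k₄-map f h (k₄ pq pr ps qr qs rs) = k₄ (h pq) (h pr) (h ps) (h qr) (h qs) (h rs)

k₄-invariant : Invariant K₄
k₄-invariant i = k₄-map (to (bij i)) (pres i)

-- A step destroys only the edges ab and cd, so a K₄ without a and d keeps all its edges. The next a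
-- and d are the old d and the new vertex, which it avoids as well: the condition is preserved
-- forever.
AvoidingK₄ : ∀ {n X} {S : Rel X} → Growing n S → Set
AvoidingK₄ s = Σ (K₄ (graph (Growing.packing s))) λ k →
  K₄.Avoids k (Growing.a s) × K₄.Avoids k (Growing.d s)

module _ {n : ℕ} {X : Set} {S : Rel X} (s : Growing n S) where
  open Growing s using (R₁; R₂; a; b; c; d; ab; cd; apart; h₁; h₂)

  private
    G = graph (Growing.packing s)
    G⁺ = graph (Growing.packing (grow-step s))

  grow-avoidingK₄ : AvoidingK₄ s → AvoidingK₄ (grow-step s)
  grow-avoidingK₄ (k₄ pq pr ps qr qs rs , (ap , aq , ar , as) , (dp , dq , dr , ds)) =
    k₄ (keep ap aq dp dq pq) (keep ap ar dp dr pr) (keep ap as dp ds ps)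
       (keep aq ar dq dr qr) (keep aq as dq ds qs) (keep ar as dr ds rs) ,
    (just-≢ dp , just-≢ dq , just-≢ dr , just-≢ ds) ,
    ((λ ()) , (λ ()) , (λ ()) , (λ ()))
    where
    keep : ∀ {u v} → a ≢ u → a ≢ v → d ≢ u → d ≢ v → G u v → G⁺ (just u) (just v)
    keep au av _ _ (inj₁ r) = inj₂ (r , [ ≢-sym au ∘ proj₁ , ≢-sym av ∘ proj₂ ])
    keep _ _ du dv (inj₂ r) = inj₁ (r , [ ≢-sym dv ∘ proj₂ , ≢-sym du ∘ proj₁ ])

  -- The neighbours of the new vertex are a, b, c, d, and neither ab nor cd is an edge any more:
  -- three of these vertices never form a triangle.
  grow-K₄-free : Symmetric S → Irreflexive S → ¬ K₄ G → ¬ K₄ G⁺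
  grow-K₄-free S-sym S-irrefl ¬k = λ
    { (k₄ {nothing} {just x} {just y} {just z} xp yp zp xy xz yz) → triangle xp yp zp xy xz yz
    ; (k₄ {just x} {nothing} {just y} {just z} xp xy xz yp zp yz) → triangle (sym⁺ xp) yp zp xy xz yz
    ; (k₄ {just x} {just y} {nothing} {just z} xy xp xz yp yz zp) → triangle (sym⁺ xp) (sym⁺ yp) zp xy xz yz
    ; (k₄ {just x} {just y} {just z} {nothing} xy xz xp yz yp zp) → triangle (sym⁺ xp) (sym⁺ yp) (sym⁺ zp) xy xz yz
    ; (k₄ {just _} {just _} {just _} {just _} pq pr ps qr qs rs) →
        ¬k (k₄ (old pq) (old pr) (old ps) (old qr) (old qs) (old rs))
    ; (k₄ {nothing} {nothing} pq _ _ _ _ _) → irr⁺ pq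
    ; (k₄ {nothing} {just _} {nothing} _ pr _ _ _ _) → irr⁺ pr
    ; (k₄ {nothing} {just _} {just _} {nothing} _ _ ps _ _ _) → irr⁺ ps
    ; (k₄ {just _} {nothing} {nothing} _ _ _ qr _ _) → irr⁺ qr
    ; (k₄ {just _} {nothing} {just _} {nothing} _ _ _ _ qs _) → irr⁺ qs
    ; (k₄ {just _} {just _} {nothing} {nothing} _ _ _ _ _ rs) → irr⁺ rs }
    where
    E-sym : Symmetric (CycAdj (3 + n) ⊕ S)
    E-sym = ⊕-symmetric (λ _ _ → adj-sym) S-sym
    E-irrefl : Irreflexive (CycAdj (3 + n) ⊕ S)
    E-irrefl = ⊕-irreflexive (λ _ → adj-irrefl) S-irrefl
    sym₁ : ∀ {u v} → R₁ u v → R₁ v u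
    sym₁ = symmetric-≅ h₁ E-sym _ _
    sym₂ : ∀ {u v} → R₂ u v → R₂ v u
    sym₂ = symmetric-≅ h₂ E-sym _ _
    irr : ∀ {u} → ¬ G u u
    irr (inj₁ r) = irreflexive-≅ h₁ E-irrefl _ r
    irr (inj₂ r) = irreflexive-≅ h₂ E-irrefl _ r
    old : ∀ {u v} → G⁺ (just u) (just v) → G u v
    old (inj₁ (r , _)) = inj₂ r
    old (inj₂ (r , _)) = inj₁ r
    irr⁺ : ¬ G⁺ nothing nothing
    irr⁺ (inj₁ ())
    irr⁺ (inj₂ ())
    sym⁺ : ∀ {u} → G⁺ (just u) nothing → G⁺ nothing (just u)
    sym⁺ r = r
    -- The edge ab belonged to `R₁`, where the subdivision removes it, and disjointness keeps it out
    -- of `R₂`.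
    ¬ab : ∀ {u v} → u ≡ a ⊎ u ≡ b → v ≡ a ⊎ v ≡ b → ¬ G⁺ (just u) (just v)
    ¬ab (inj₁ refl) (inj₁ refl) r = irr (old r)
    ¬ab (inj₂ refl) (inj₂ refl) r = irr (old r)
    ¬ab (inj₁ refl) (inj₂ refl) (inj₁ (r , _)) = apart ab r
    ¬ab (inj₁ refl) (inj₂ refl) (inj₂ (_ , ne)) = ne (inj₁ (refl , refl))
    ¬ab (inj₂ refl) (inj₁ refl) (inj₁ (r , _)) = apart (sym₁ ab) r
    ¬ab (inj₂ refl) (inj₁ refl) (inj₂ (_ , ne)) = ne (inj₂ (refl , refl))
    ¬cd : ∀ {u v} → u ≡ c ⊎ u ≡ d → v ≡ c ⊎ v ≡ d → ¬ G⁺ (just u) (just v)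
    ¬cd (inj₁ refl) (inj₁ refl) r = irr (old r)
    ¬cd (inj₂ refl) (inj₂ refl) r = irr (old r)
    ¬cd (inj₁ refl) (inj₂ refl) (inj₂ (r , _)) = apart r cd
    ¬cd (inj₁ refl) (inj₂ refl) (inj₁ (_ , ne)) = ne (inj₁ (refl , refl))
    ¬cd (inj₂ refl) (inj₁ refl) (inj₂ (r , _)) = apart r (sym₂ cd)
    ¬cd (inj₂ refl) (inj₁ refl) (inj₁ (_ , ne)) = ne (inj₂ (refl , refl))
    triangle : ∀ {x y z} → G⁺ nothing (just x) → G⁺ nothing (just y) → G⁺ nothing (just z) →
      G⁺ (just x) (just y) → G⁺ (just x) (just z) → ¬ G⁺ (just y) (just z)
    -- Pigeonhole: two of the three edges to the new vertex have the same colour.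
    triangle (inj₁ x) (inj₁ y) _ xy _ _ = ¬cd x y xy
    triangle (inj₂ x) (inj₂ y) _ xy _ _ = ¬ab x y xy
    triangle (inj₁ x) _ (inj₁ z) _ xz _ = ¬cd x z xz
    triangle (inj₂ x) _ (inj₂ z) _ xz _ = ¬ab x z xz
    triangle _ (inj₁ y) (inj₁ z) _ _ yz = ¬cd y z yz
    triangle _ (inj₂ y) (inj₂ z) _ _ yz = ¬ab y z yz

-- Connected packings

-- An invariant under the addition of a cycle of any length: connectedness is what the comparison
-- with a split embedding needs, and the pair is what a further triangle needs.
record Good {V : Set} (E : Rel V) : Set₁ where
  constructor good
  field
    packing   : Packing E
    connected : Connected (graph packing)
    pair      : NonAdjacentPair (graph packing)

good-≅ : {V W : Set} {E : Rel V} {F : Rel W} → E ≅ F → Good E → Good F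
good-≅ i (good p c x) = good (packing-≅ i p) c x

grow-by : ∀ {X} {S : Rel X} (P : ∀ {n} → Growing n S → Set) →
  (∀ {n} (s : Growing n S) → P s → P (grow-step s)) →
  ∀ {n} k (s : Growing n S) → P s → Σ (Growing (k + n) S) P
grow-by P step zero s ps = s , ps
grow-by P step (suc k) s ps with t , pt ← grow-by P step k s ps = grow-step t , step t pt

grow-good : ∀ {n X} {S : Rel X} → DecidableEquality X → ∀ k (s : Growing n S) →
  Connected (graph (Growing.packing s)) → NonAdjacentPair (graph (Growing.packing s)) →
  Good (CycAdj (3 + (k + n)) ⊕ S)
grow-good {S = S} _≟ˣ_ k s c x
  with t , ct , xt ← grow-by
         (λ s → Connected (graph (Growing.packing s)) × NonAdjacentPair (graph (Growing.packing s)))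
         (λ s (c , x) → grow-connected s (≟-transport (bij (Growing.h₁ s)) (⊎-≡-dec _≟_ _≟ˣ_)) c ,
                        grow-nonAdjacentPair s x)
         k s (c , x)
  = good (Growing.packing t) ct xt

module _ {V : Set} {E : Rel V} (_≟ⱽ_ : DecidableEquality V) where

  -- Any two vertices of a triangle are adjacent, so their exchange partners must not be.
  add-triangle : Good E → Good (CycAdj 3 ⊕ E)
  add-triangle (good p c (nonAdjacentPair x≢y ¬xy ¬yx)) =
    good-≅ ⊕-comm (good A.packing
      (A.connected {o = zero} (inj₂ (inj₁ refl)) (inj₁ (inj₂ (refl , refl))) (λ ()) (λ ()) c) A.newPair)
    where
    cover : ∀ {i j} → CycAdj 3 i j → (i ≡ suc zero ⊎ i ≡ suc (suc zero)) ⊎ (j ≡ suc zero ⊎ j ≡ suc (suc zero))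
    cover {suc zero} _ = inj₁ (inj₁ refl)
    cover {suc (suc zero)} _ = inj₁ (inj₂ refl)
    cover {zero} {suc zero} _ = inj₂ (inj₁ refl)
    cover {zero} {suc (suc zero)} _ = inj₂ (inj₂ refl)
    cover {zero} {zero} e = ⊥-elim (adj-irrefl e)
    module A = AddCycle p (≟-transport (bij (red p)) _≟ⱽ_) x≢y {s = suc zero} {suc (suc zero)}
                 (λ ()) (inj₂ (¬xy , ¬yx)) cover

  -- Opposite vertices of C₄ are non-adjacent and cover all its edges, so they can be exchanged with
  -- any two distinct vertices, even in the packing of C₅, which is complete. The C₄ is then
  -- lengthened k times.
  add-long-cycle : (p : Packing E) → Connected (graph p) → {x y : W p} → x ≢ y →
    ∀ k → Good (CycAdj (3 + (k + 1)) ⊕ E)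
  add-long-cycle p c {x} {y} x≢y k = grow-good _≟ⱽ_ k s
    (A.connected {o = zero} (inj₂ (inj₁ refl)) (inj₁ (inj₂ (refl , refl))) (λ ()) (λ ()) c) A.newPair
    where
    ¬13 : ¬ CycAdj 4 (suc zero) (suc (suc (suc zero)))
    ¬13 (inj₁ (inj₁ ()))
    ¬13 (inj₁ (inj₂ (() , _)))
    ¬13 (inj₂ (inj₁ ()))
    ¬13 (inj₂ (inj₂ (_ , ())))
    ¬02 : ¬ CycAdj 4 zero (suc (suc zero))
    ¬02 (inj₁ (inj₁ ()))
    ¬02 (inj₁ (inj₂ (() , _)))
    ¬02 (inj₂ (inj₁ ()))
    ¬02 (inj₂ (inj₂ (() , _)))
    cover : ∀ {i j} → CycAdj 4 i j →
      (i ≡ suc zero ⊎ i ≡ suc (suc (suc zero))) ⊎ (j ≡ suc zero ⊎ j ≡ suc (suc (suc zero)))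
    cover {suc zero} _ = inj₁ (inj₁ refl)
    cover {suc (suc (suc zero))} _ = inj₁ (inj₂ refl)
    cover {zero} {suc zero} _ = inj₂ (inj₁ refl)
    cover {zero} {suc (suc (suc zero))} _ = inj₂ (inj₂ refl)
    cover {suc (suc zero)} {suc zero} _ = inj₂ (inj₁ refl)
    cover {suc (suc zero)} {suc (suc (suc zero))} _ = inj₂ (inj₂ refl)
    cover {zero} {zero} e = ⊥-elim (adj-irrefl e)
    cover {suc (suc zero)} {suc (suc zero)} e = ⊥-elim (adj-irrefl e)
    cover {zero} {suc (suc zero)} e = ⊥-elim (¬02 e)
    cover {suc (suc zero)} {zero} e = ⊥-elim (¬02 (adj-sym e))
    module A = AddCycle p (≟-transport (bij (red p)) _≟ⱽ_) x≢y {s = suc zero} {suc (suc (suc zero))}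
                 (λ ()) (inj₁ ¬13) cover
    s : Growing 1 E
    s = record
      { h₁ = ≅-trans ⊕-comm (red A.packing)
      -- Rotating by two turns the indices 3, 0, 1 into 1, 2, 3, whose blue places are x, the vertex
      -- 2 of the cycle, and y. These are c, d, e, distinct from the cycle vertices 3 and 0 that
      -- serve as a and b.
      ; h₂ = ≅-trans (⊕-cong (≅-trans rotation rotation) ≅-refl) (≅-trans ⊕-comm (blue A.packing))
      ; apart = λ {u} {v} → disjoint A.packing {u} {v}
      ; a-def = refl
      ; b-def = refl
      ; c-def = A.τ-def A.s↦x
      ; d-def = A.τ-def (A.new {k = suc (suc zero)} (λ ()) (λ ()))
      ; e-def = A.τ-def A.t↦y
      ; a≢c = λ () ; a≢d = λ () ; a≢e = λ () ; b≢c = λ () ; b≢d = λ () ; b≢e = λ () }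

add-cycle : ∀ {V} {E : Rel V} {n} → DecidableEquality V → 3 ≤ n → Good E → Good (CycAdj n ⊕ E)
add-cycle {n = 3} d _ g = add-triangle d g
add-cycle {E = E} {suc (suc (suc (suc n)))} d _ (good p c (nonAdjacentPair x≢y _ _)) =
  subst (λ k → Good (CycAdj (3 + k) ⊕ E)) (ℕₚ.+-comm n 1) (add-long-cycle d p c x≢y n)
add-cycle {n = 1} d (s≤s ())
add-cycle {n = 2} d (s≤s (s≤s ()))

Prism : GraphProperty
Prism E = ∃ λ a → ∃ λ b → E a b × ∃ λ c → (E a c × E b c) ×
  ∃ λ a′ → (E a a′ × a′ ≢ b × a′ ≢ c) ×
  ∃ λ b′ → (E b b′ × E a′ b′ × b′ ≢ a × b′ ≢ c) ×
  ∃ λ c′ → E c c′ × E a′ c′ × E b′ c′ × c′ ≢ a × c′ ≢ b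

prism-invariant : Invariant Prism
prism-invariant {E = E} {F} i
  (a , b , ab , c , (ac , bc) , a′ , (aa′ , a′≢b , a′≢c) ,
   b′ , (bb′ , a′b′ , b′≢a , b′≢c) , c′ , cc′ , a′c′ , b′c′ , c′≢a , c′≢b) =
  f a , f b , p ab , f c , (p ac , p bc) , f a′ , (p aa′ , n a′≢b , n a′≢c) ,
  f b′ , (p bb′ , p a′b′ , n b′≢a , n b′≢c) , f c′ , p cc′ , p a′c′ , p b′c′ , n c′≢a , n c′≢b
  where
  f = to (bij i)
  p : ∀ {u v} → E u v → F (f u) (f v)
  p = pres i
  n : ∀ {u v} → u ≢ v → f u ≢ f v
  n u≢v e = u≢v (trans (sym (strictlyInverseʳ (bij i) _))
    (trans (cong (from (bij i)) e) (strictlyInverseʳ (bij i) _)))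

-- Tabulated embeddings

step? : ∀ m i j → Dec (Step m i j)
step? m i j = (suc (toℕ i) ≟ℕ toℕ j) ⊎-dec ((suc (toℕ i) ≟ℕ m) ×-dec (toℕ j ≟ℕ 0))

union? : ∀ ns u v → Dec (CycUnion ns u v)
union? ns (i , a) (j , b) with i ≟ j
... | no i≢j = no (i≢j ∘ proj₁)
... | yes refl = map′ (λ e → refl , e) (λ { (refl , e) → e }) (step? _ a b ⊎-dec step? _ b a)

holds : {A : Set} (a? : Dec A) → does a? ≡ true → A
holds (yes a) _ = a

fails : {A : Set} (a? : Dec A) → does a? ≡ false → ¬ A
fails (no ¬a) _ = ¬a

code : ∀ ns → CVert ns → ℕ
code (n ∷ ns) (zero , a) = toℕ a
code (n ∷ ns) (suc i , a) = n + code ns (i , a)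

decode : ∀ ns → ℕ → Maybe (CVert ns)
decode [] _ = nothing
decode (n ∷ ns) k with k <? n
... | yes k<n = just (zero , fromℕ< k<n)
... | no _ = mapᵐ (λ (i , a) → suc i , a) (decode ns (k ∸ n))

entry : List ℕ → ℕ → ℕ
entry [] _ = 0
entry (x ∷ xs) zero = x
entry (x ∷ xs) (suc k) = entry xs k

position : List ℕ → ℕ → ℕ
position [] _ = 0
position (x ∷ xs) k with x ≟ℕ k
... | yes _ = 0
... | no _ = suc (position xs k)

-- A vertex stays where it is when f does not yield the code of a vertex.
relabel : ∀ ns → (ℕ → ℕ) → CVert ns → CVert ns
relabel ns f v = fromMaybe v (decode ns (f (code ns v)))

module Tables (ns : List ℕ) where

  V = CVert ns
  E = CycUnion ns

  ∀? : {P : V → Set} → (∀ v → Dec (P v)) → Dec (∀ v → P v)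
  ∀? P? = map′ (λ f (i , a) → f i a) (λ f i a → f (i , a)) (Finₚ.all? λ i → Finₚ.all? λ a → P? (i , a))

  ∃? : {P : V → Set} → (∀ v → Dec (P v)) → Dec (∃ P)
  ∃? P? = map′ (λ (i , a , p) → (i , a) , p) (λ ((i , a) , p) → i , a , p)
    (Finₚ.any? λ i → Finₚ.any? λ a → P? (i , a))

  infix 4 _≢?_

  _≢?_ : (u v : V) → Dec (u ≢ v)
  u ≢? v = ¬? (vertex-≟ ns u v)

  -- A permutation is tabulated by the list of the codes of its values.
  IsTable : List ℕ → Set
  IsTable t = (∀ v → relabel ns (entry t) (relabel ns (position t) v) ≡ v)
            × (∀ v → relabel ns (position t) (relabel ns (entry t) v) ≡ v)

  isTable? : ∀ t → Dec (IsTable t)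
  isTable? t = ∀? (λ v → vertex-≟ ns (relabel ns (entry t) (relabel ns (position t) v)) v)
         ×-dec ∀? (λ v → vertex-≟ ns (relabel ns (position t) (relabel ns (entry t) v)) v)

  perm : ∀ t → IsTable t → Perm V
  perm t (p , q) = mk↔ₛ′ (relabel ns (entry t)) (relabel ns (position t)) p q

  Valid : List ℕ → Set
  Valid t = Σ (IsTable t) (λ p → IsEmbedding E (perm t p))

  valid? : ∀ t → Dec (Valid t)
  valid? t with isTable? t
  ... | no n = no (n ∘ proj₁)
  ... | yes p = map′ (p ,_) proj₂ (∀? λ u → ∀? λ v →
      union? ns u v →-dec ¬? (union? ns (relabel ns (entry t) u) (relabel ns (entry t) v)))

  module _ (σ : Perm V) where

    F : Rel V
    F = Oplus E σ

    F? : ∀ u v → Dec (F u v)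
    F? u v = union? ns u v ⊎-dec union? ns (from σ u) (from σ v)

    -- Conditions are interleaved with the choice of vertices for early pruning. The predicate is
    -- trivial for the plain existence of a K₄ and excludes a and d in the starting packing of a
    -- family.
    K₄Within : (V → Set) → Set
    K₄Within P = ∃ λ p → P p × ∃ λ q → (F p q × P q) × ∃ λ r → (F p r × F q r × P r) ×
      ∃ λ s → F p s × F q s × F r s × P s

    k₄Within? : {P : V → Set} → (∀ v → Dec (P v)) → Dec (K₄Within P)
    k₄Within? P? = ∃? λ p → P? p ×-dec ∃? λ q → (F? p q ×-dec P? q) ×-dec
      ∃? λ r → (F? p r ×-dec F? q r ×-dec P? r) ×-dec
      ∃? λ s → F? p s ×-dec F? q s ×-dec F? r s ×-dec P? s

    k₄? : Dec (K₄ F)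
    k₄? = map′
      (λ (p , _ , q , (pq , _) , r , (pr , qr , _) , s , ps , qs , rs , _) → k₄ pq pr ps qr qs rs)
      (λ (k₄ pq pr ps qr qs rs) → _ , tt , _ , (pq , tt) , _ , (pr , qr , tt) , _ , ps , qs , rs , tt)
      (k₄Within? (λ _ → yes tt))

    prism? : Dec (Prism F)
    prism? = ∃? λ a → ∃? λ b → F? a b ×-dec ∃? λ c → (F? a c ×-dec F? b c) ×-dec
      ∃? λ a′ → (F? a a′ ×-dec a′ ≢? b ×-dec a′ ≢? c) ×-dec
      ∃? λ b′ → (F? b b′ ×-dec F? a′ b′ ×-dec b′ ≢? a ×-dec b′ ≢? c) ×-dec
      ∃? λ c′ → F? c c′ ×-dec F? a′ c′ ×-dec F? b′ c′ ×-dec c′ ≢? a ×-dec c′ ≢? b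

    pair? : Dec (NonAdjacentPair F)
    pair? = map′ (λ (x , y , p , q , r) → nonAdjacentPair p q r)
      (λ (nonAdjacentPair p q r) → _ , _ , p , q , r)
      (∃? λ x → ∃? λ y → x ≢? y ×-dec ¬? (F? x y) ×-dec ¬? (F? y x))

    -- A certificate of connectedness: choosing a neighbour of smaller code for every vertex but the
    -- root gives a spanning tree.
    Descending : V → Set
    Descending root = ∀ v → v ≡ root ⊎ ∃ λ u → code ns u < code ns v × F u v

    descending? : ∀ root → Dec (Descending root)
    descending? root = ∀? λ v → vertex-≟ ns v root ⊎-dec ∃? λ u → (code ns u <? code ns v) ×-dec F? u v

    descending⇒connected : ∀ {root} → Descending root → Connected F
    descending⇒connected {root} desc f h u v =
      trans (toRoot u (<-wellFounded _)) (sym (toRoot v (<-wellFounded _)))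
      where
      toRoot : ∀ v → Acc _<_ (code ns v) → f v ≡ f root
      toRoot v (acc rec) with desc v
      ... | inj₁ refl = refl
      ... | inj₂ (u , u<v , e) = trans (sym (h u v e)) (toRoot u (rec u<v))

  tablePerm : ∀ t → Valid t → Perm V
  tablePerm t valid = perm t (proj₁ valid)

  tablePacking : ∀ t → Valid t → Packing E
  tablePacking t valid = embedding→packing (tablePerm t valid) (proj₂ valid)

  goodTable : ∀ t (valid : Valid t) {root : V} → Descending (tablePerm t valid) root →
    NonAdjacentPair (F (tablePerm t valid)) → Good E
  goodTable t valid desc pair = good (tablePacking t valid) (descending⇒connected (tablePerm t valid) desc) pair

  twoDistinctTables : ∀ t t′ (valid : Valid t) (valid′ : Valid t′) →
    Prism (F (tablePerm t valid)) → ¬ Prism (F (tablePerm t′ valid′)) → TwoDistinctEmbeddings E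
  twoDistinctTables t t′ valid valid′ =
    twoDistinct Prism prism-invariant (tablePacking t valid) (tablePacking t′ valid′)

module GrowingTables (n : ℕ) (ms : List ℕ) (t : List ℕ) where

  open Tables (3 + n ∷ ms) public

  module _ (valid : Valid t) where

    private
      σ = tablePerm t valid
      p = tablePacking t valid

      last first a b c d e : V
      last  = zero , fromℕ (2 + n)
      first = zero , zero
      a = last
      b = first
      c = to σ last
      d = to σ first
      e = to σ (zero , suc zero)

    Separated : Set
    Separated = (a ≢ c × a ≢ d × a ≢ e) × (b ≢ c × b ≢ d × b ≢ e)

    separated? : Dec Separated
    separated? = (a ≢? c ×-dec a ≢? d ×-dec a ≢? e) ×-dec (b ≢? c ×-dec b ≢? d ×-dec b ≢? e)

    growing : Separated → Growing n (CycUnion ms)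
    growing ((a≢c , a≢d , a≢e) , (b≢c , b≢d , b≢e)) = record
      { h₁ = ≅-sym (union-∷ _ ms)
      ; h₂ = ≅-trans (≅-sym (union-∷ _ ms)) (blue p)
      ; apart = disjoint p
      ; a-def = refl ; b-def = refl ; c-def = refl ; d-def = refl ; e-def = refl
      ; a≢c = a≢c ; a≢d = a≢d ; a≢e = a≢e ; b≢c = b≢c ; b≢d = b≢d ; b≢e = b≢e }

    Outside : V → Set
    Outside v = a ≢ v × d ≢ v

    outside? : ∀ v → Dec (Outside v)
    outside? v = a ≢? v ×-dec d ≢? v

    avoiding : (sep : Separated) → K₄Within σ Outside → AvoidingK₄ (growing sep)
    avoiding sep (p , (ap , dp) , q , (pq , (aq , dq)) , r , (pr , qr , (ar , dr)) , s , ps , qs , rs , (as , ds)) =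
      k₄ pq pr ps qr qs rs , (ap , aq , ar , as) , (dp , dq , dr , ds)

module GrowingFamily (n : ℕ) (ms : List ℕ) (3≤ms : All (3 ≤_) ms) (t t′ : List ℕ) where

  module T = GrowingTables n ms t
  module T′ = GrowingTables n ms t′

  -- Both tables are lengthened by the same number of steps, so they remain packings of one graph,
  -- and each keeps its own answer about K₄.
  twoDistinctFamily : (valid : T.Valid t) (valid′ : T′.Valid t′) (sep : T.Separated valid) →
    T.K₄Within (T.tablePerm t valid) (T.Outside valid) → T′.Separated valid′ →
    ¬ K₄ (T.F (T.tablePerm t′ valid′)) →
    ∀ k → TwoDistinctEmbeddings (CycUnion (3 + (k + n) ∷ ms))
  twoDistinctFamily valid valid′ sep k₄s sep′ ¬k₄ k
    with s , avoid ← grow-by AvoidingK₄ grow-avoidingK₄ k (T.growing valid sep) (T.avoiding valid sep k₄s)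
       | s′ , free ← grow-by (λ s → ¬ K₄ (graph (Growing.packing s)))
           (λ s → grow-K₄-free s (union-symmetric ms) (union-irreflexive 3≤ms)) k (T′.growing valid′ sep′) ¬k₄
    = twoDistinct-≅ (≅-sym (union-∷ _ ms))
        (twoDistinct K₄ k₄-invariant (Growing.packing s) (Growing.packing s′) (proj₁ avoid) free)

-- The tables of this section were found by a computer search.

3≤3+n : ∀ {n} → 3 ≤ 3 + n
3≤3+n = s≤s (s≤s (s≤s z≤n))

module Family-8 where

  t t′ : List ℕ
  t = 6 ∷ 4 ∷ 7 ∷ 5 ∷ 2 ∷ 0 ∷ 3 ∷ 1 ∷ []
  t′ = 5 ∷ 2 ∷ 6 ∷ 0 ∷ 4 ∷ 7 ∷ 3 ∷ 1 ∷ []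
  module T = GrowingTables 5 [] t
  module T′ = GrowingTables 5 [] t′

  valid : T.Valid t
  valid = holds (T.valid? t) refl
  valid′ : T′.Valid t′
  valid′ = holds (T′.valid? t′) refl

  twoDistinct-8+ : ∀ k → TwoDistinctEmbeddings (CycUnion (3 + (k + 5) ∷ []))
  twoDistinct-8+ = GrowingFamily.twoDistinctFamily 5 [] [] t t′ valid valid′
    (holds (T.separated? valid) refl)
    (holds (T.k₄Within? (T.tablePerm t valid) (T.outside? valid)) refl)
    (holds (T′.separated? valid′) refl)
    (fails (T.k₄? (T.tablePerm t′ valid′)) refl)

open Family-8 using (twoDistinct-8+)

module Family-7-3 where

  t t′ : List ℕ
  t = 9 ∷ 2 ∷ 0 ∷ 3 ∷ 1 ∷ 7 ∷ 5 ∷ 4 ∷ 6 ∷ 8 ∷ []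
  t′ = 8 ∷ 1 ∷ 3 ∷ 7 ∷ 4 ∷ 6 ∷ 2 ∷ 5 ∷ 9 ∷ 0 ∷ []
  module T = GrowingTables 4 (3 ∷ []) t
  module T′ = GrowingTables 4 (3 ∷ []) t′

  valid : T.Valid t
  valid = holds (T.valid? t) refl
  valid′ : T′.Valid t′
  valid′ = holds (T′.valid? t′) refl

  twoDistinct-7-3+ : ∀ k → TwoDistinctEmbeddings (CycUnion (3 + (k + 4) ∷ 3 ∷ []))
  twoDistinct-7-3+ = GrowingFamily.twoDistinctFamily 4 (3 ∷ []) (3≤3+n ∷ []) t t′ valid valid′
    (holds (T.separated? valid) refl)
    (holds (T.k₄Within? (T.tablePerm t valid) (T.outside? valid)) refl)
    (holds (T′.separated? valid′) refl)
    (fails (T.k₄? (T.tablePerm t′ valid′)) refl)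

open Family-7-3 using (twoDistinct-7-3+)

module Family-4-4 where

  t t′ : List ℕ
  t = 2 ∷ 6 ∷ 3 ∷ 5 ∷ 0 ∷ 7 ∷ 1 ∷ 4 ∷ []
  t′ = 6 ∷ 4 ∷ 0 ∷ 2 ∷ 3 ∷ 5 ∷ 1 ∷ 7 ∷ []
  module T = GrowingTables 1 (4 ∷ []) t
  module T′ = GrowingTables 1 (4 ∷ []) t′

  valid : T.Valid t
  valid = holds (T.valid? t) refl
  valid′ : T′.Valid t′
  valid′ = holds (T′.valid? t′) refl

  twoDistinct-4-4+ : ∀ k → TwoDistinctEmbeddings (CycUnion (3 + (k + 1) ∷ 4 ∷ []))
  twoDistinct-4-4+ = GrowingFamily.twoDistinctFamily 1 (4 ∷ []) (3≤3+n ∷ []) t t′ valid valid′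
    (holds (T.separated? valid) refl)
    (holds (T.k₄Within? (T.tablePerm t valid) (T.outside? valid)) refl)
    (holds (T′.separated? valid′) refl)
    (fails (T.k₄? (T.tablePerm t′ valid′)) refl)

open Family-4-4 using (twoDistinct-4-4+)

module Family-6-3-3 where

  t t′ : List ℕ
  t = 7 ∷ 1 ∷ 3 ∷ 0 ∷ 2 ∷ 11 ∷ 10 ∷ 5 ∷ 6 ∷ 9 ∷ 8 ∷ 4 ∷ []
  t′ = 8 ∷ 10 ∷ 3 ∷ 0 ∷ 7 ∷ 1 ∷ 5 ∷ 9 ∷ 2 ∷ 6 ∷ 4 ∷ 11 ∷ []
  module T = GrowingTables 3 (3 ∷ 3 ∷ []) t
  module T′ = GrowingTables 3 (3 ∷ 3 ∷ []) t′

  valid : T.Valid t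
  valid = holds (T.valid? t) refl
  valid′ : T′.Valid t′
  valid′ = holds (T′.valid? t′) refl

  twoDistinct-6-3-3+ : ∀ k → TwoDistinctEmbeddings (CycUnion (3 + (k + 3) ∷ 3 ∷ 3 ∷ []))
  twoDistinct-6-3-3+ = GrowingFamily.twoDistinctFamily 3 (3 ∷ 3 ∷ []) (3≤3+n ∷ 3≤3+n ∷ []) t t′ valid valid′
    (holds (T.separated? valid) refl)
    (holds (T.k₄Within? (T.tablePerm t valid) (T.outside? valid)) refl)
    (holds (T′.separated? valid′) refl)
    (fails (T.k₄? (T.tablePerm t′ valid′)) refl)

open Family-6-3-3 using (twoDistinct-6-3-3+)

twoDistinct-7 : TwoDistinctEmbeddings (CycUnion (7 ∷ []))
twoDistinct-7 = twoDistinctTables t t′ valid valid′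
  (holds (prism? (tablePerm t valid)) refl) (fails (prism? (tablePerm t′ valid′)) refl)
  where
  open Tables (7 ∷ [])
  t t′ : List ℕ
  t = 2 ∷ 6 ∷ 3 ∷ 1 ∷ 4 ∷ 0 ∷ 5 ∷ []
  t′ = 6 ∷ 4 ∷ 0 ∷ 2 ∷ 5 ∷ 1 ∷ 3 ∷ []
  valid = holds (valid? t) refl
  valid′ = holds (valid? t′) refl

twoDistinct-6-3 : TwoDistinctEmbeddings (CycUnion (6 ∷ 3 ∷ []))
twoDistinct-6-3 = twoDistinctTables t t′ valid valid′
  (holds (prism? (tablePerm t valid)) refl) (fails (prism? (tablePerm t′ valid′)) refl)
  where
  open Tables (6 ∷ 3 ∷ [])
  t t′ : List ℕ
  t = 4 ∷ 6 ∷ 1 ∷ 7 ∷ 3 ∷ 0 ∷ 8 ∷ 2 ∷ 5 ∷ []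
  t′ = 2 ∷ 8 ∷ 3 ∷ 7 ∷ 0 ∷ 4 ∷ 1 ∷ 5 ∷ 6 ∷ []
  valid = holds (valid? t) refl
  valid′ = holds (valid? t′) refl

twoDistinct-5-3-3 : TwoDistinctEmbeddings (CycUnion (5 ∷ 3 ∷ 3 ∷ []))
twoDistinct-5-3-3 = twoDistinctTables t t′ valid valid′
  (holds (prism? (tablePerm t valid)) refl) (fails (prism? (tablePerm t′ valid′)) refl)
  where
  open Tables (5 ∷ 3 ∷ 3 ∷ [])
  t t′ : List ℕ
  t = 1 ∷ 3 ∷ 8 ∷ 2 ∷ 7 ∷ 4 ∷ 6 ∷ 10 ∷ 9 ∷ 0 ∷ 5 ∷ []
  t′ = 0 ∷ 6 ∷ 3 ∷ 10 ∷ 5 ∷ 1 ∷ 4 ∷ 9 ∷ 7 ∷ 8 ∷ 2 ∷ []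
  valid = holds (valid? t) refl
  valid′ = holds (valid? t′) refl

twoDistinct-4-3-3 : TwoDistinctEmbeddings (CycUnion (4 ∷ 3 ∷ 3 ∷ []))
twoDistinct-4-3-3 = twoDistinctTables t t′ valid valid′
  (holds (prism? (tablePerm t valid)) refl) (fails (prism? (tablePerm t′ valid′)) refl)
  where
  open Tables (4 ∷ 3 ∷ 3 ∷ [])
  t t′ : List ℕ
  t = 1 ∷ 9 ∷ 4 ∷ 3 ∷ 6 ∷ 0 ∷ 7 ∷ 5 ∷ 2 ∷ 8 ∷ []
  t′ = 6 ∷ 9 ∷ 1 ∷ 8 ∷ 2 ∷ 0 ∷ 5 ∷ 4 ∷ 3 ∷ 7 ∷ []
  valid = holds (valid? t) refl
  valid′ = holds (valid? t′) refl

twoDistinct-3-4-4 : TwoDistinctEmbeddings (CycUnion (3 ∷ 4 ∷ 4 ∷ []))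
twoDistinct-3-4-4 = twoDistinctTables t t′ valid valid′
  (holds (prism? (tablePerm t valid)) refl) (fails (prism? (tablePerm t′ valid′)) refl)
  where
  open Tables (3 ∷ 4 ∷ 4 ∷ [])
  t t′ : List ℕ
  t = 4 ∷ 8 ∷ 1 ∷ 2 ∷ 10 ∷ 0 ∷ 6 ∷ 7 ∷ 9 ∷ 5 ∷ 3 ∷ []
  t′ = 2 ∷ 5 ∷ 3 ∷ 10 ∷ 1 ∷ 6 ∷ 8 ∷ 4 ∷ 0 ∷ 7 ∷ 9 ∷ []
  valid = holds (valid? t) refl
  valid′ = holds (valid? t′) refl

twoDistinct-4-4-4 : TwoDistinctEmbeddings (CycUnion (4 ∷ 4 ∷ 4 ∷ []))
twoDistinct-4-4-4 = twoDistinctTables t t′ valid valid′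
  (holds (prism? (tablePerm t valid)) refl) (fails (prism? (tablePerm t′ valid′)) refl)
  where
  open Tables (4 ∷ 4 ∷ 4 ∷ [])
  t t′ : List ℕ
  t = 4 ∷ 6 ∷ 3 ∷ 10 ∷ 8 ∷ 1 ∷ 5 ∷ 7 ∷ 2 ∷ 0 ∷ 11 ∷ 9 ∷ []
  t′ = 3 ∷ 4 ∷ 10 ∷ 6 ∷ 0 ∷ 2 ∷ 5 ∷ 11 ∷ 1 ∷ 9 ∷ 7 ∷ 8 ∷ []
  valid = holds (valid? t) refl
  valid′ = holds (valid? t′) refl

twoDistinct-3-3-3-4 : TwoDistinctEmbeddings (CycUnion (3 ∷ 3 ∷ 3 ∷ 4 ∷ []))
twoDistinct-3-3-3-4 = twoDistinctTables t t′ valid valid′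
  (holds (prism? (tablePerm t valid)) refl) (fails (prism? (tablePerm t′ valid′)) refl)
  where
  open Tables (3 ∷ 3 ∷ 3 ∷ 4 ∷ [])
  t t′ : List ℕ
  t = 2 ∷ 7 ∷ 11 ∷ 4 ∷ 8 ∷ 12 ∷ 9 ∷ 3 ∷ 6 ∷ 0 ∷ 5 ∷ 1 ∷ 10 ∷ []
  t′ = 7 ∷ 11 ∷ 1 ∷ 0 ∷ 6 ∷ 4 ∷ 3 ∷ 2 ∷ 9 ∷ 8 ∷ 10 ∷ 5 ∷ 12 ∷ []
  valid = holds (valid? t) refl
  valid′ = holds (valid? t′) refl

twoDistinct-3-3-3-3-3 : TwoDistinctEmbeddings (CycUnion (3 ∷ 3 ∷ 3 ∷ 3 ∷ 3 ∷ []))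
twoDistinct-3-3-3-3-3 = twoDistinctTables t t′ valid valid′
  (holds (prism? (tablePerm t valid)) refl) (fails (prism? (tablePerm t′ valid′)) refl)
  where
  open Tables (3 ∷ 3 ∷ 3 ∷ 3 ∷ 3 ∷ [])
  t t′ : List ℕ
  t = 4 ∷ 2 ∷ 14 ∷ 8 ∷ 13 ∷ 9 ∷ 11 ∷ 12 ∷ 7 ∷ 3 ∷ 10 ∷ 0 ∷ 6 ∷ 5 ∷ 1 ∷ []
  t′ = 11 ∷ 0 ∷ 6 ∷ 4 ∷ 10 ∷ 7 ∷ 8 ∷ 5 ∷ 14 ∷ 2 ∷ 3 ∷ 13 ∷ 1 ∷ 12 ∷ 9 ∷ []
  valid = holds (valid? t) refl
  valid′ = holds (valid? t′) refl

good-3-3-3 : Good (CycUnion (3 ∷ 3 ∷ 3 ∷ []))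
good-3-3-3 = goodTable t valid {zero , zero} (holds (descending? (tablePerm t valid) _) refl)
  (holds (pair? (tablePerm t valid)) refl)
  where
  open Tables (3 ∷ 3 ∷ 3 ∷ [])
  t : List ℕ
  t = 3 ∷ 1 ∷ 8 ∷ 2 ∷ 4 ∷ 7 ∷ 0 ∷ 6 ∷ 5 ∷ []
  valid = holds (valid? t) refl

good-3-4 : Good (CycUnion (3 ∷ 4 ∷ []))
good-3-4 = goodTable t valid {zero , zero} (holds (descending? (tablePerm t valid) _) refl)
  (holds (pair? (tablePerm t valid)) refl)
  where
  open Tables (3 ∷ 4 ∷ [])
  t : List ℕ
  t = 3 ∷ 2 ∷ 5 ∷ 6 ∷ 1 ∷ 4 ∷ 0 ∷ []
  valid = holds (valid? t) refl

good-4-4 : Good (CycUnion (4 ∷ 4 ∷ []))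
good-4-4 = goodTable t valid {zero , zero} (holds (descending? (tablePerm t valid) _) refl)
  (holds (pair? (tablePerm t valid)) refl)
  where
  open Tables (4 ∷ 4 ∷ [])
  t : List ℕ
  t = 7 ∷ 5 ∷ 3 ∷ 1 ∷ 6 ∷ 0 ∷ 4 ∷ 2 ∷ []
  valid = holds (valid? t) refl

good-3-5 : Good (CycUnion (3 ∷ 5 ∷ []))
good-3-5 = goodTable t valid {zero , zero} (holds (descending? (tablePerm t valid) _) refl)
  (holds (pair? (tablePerm t valid)) refl)
  where
  open Tables (3 ∷ 5 ∷ [])
  t : List ℕ
  t = 3 ∷ 0 ∷ 5 ∷ 6 ∷ 1 ∷ 7 ∷ 2 ∷ 4 ∷ []
  valid = holds (valid? t) refl

good-6+ : ∀ k → Good (CycUnion (3 + (k + 3) ∷ []))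
good-6+ k = good-≅ (≅-sym (union-∷ _ [])) (grow-good (vertex-≟ []) k (growing valid sep)
  (descending⇒connected (tablePerm t valid) {zero , zero}
    (holds (descending? (tablePerm t valid) _) refl))
  (holds (pair? (tablePerm t valid)) refl))
  where
  t : List ℕ
  t = 4 ∷ 1 ∷ 5 ∷ 3 ∷ 0 ∷ 2 ∷ []
  open GrowingTables 3 [] t
  valid = holds (valid? t) refl
  sep = holds (separated? valid) refl

-- Ten edges on five vertices: this packing is all of K₅. It is connected but has no
-- `NonAdjacentPair`, hence it is kept apart from the `Good` ones.
module Pentagon where
  open Tables (5 ∷ [])

  t : List ℕ
  t = 0 ∷ 2 ∷ 4 ∷ 1 ∷ 3 ∷ []

  valid : Valid t
  valid = holds (valid? t) refl

  packing-5 : Packing E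
  packing-5 = tablePacking t valid

  connected-5 : Connected (graph packing-5)
  connected-5 = descending⇒connected (tablePerm t valid) {zero , zero}
    (holds (descending? (tablePerm t valid) _) refl)

open Pentagon using (packing-5; connected-5)

-- Exhaustive search

_==_ : Bool → Bool → Bool
true  == b = b
false == b = not b

==-sound : ∀ a b → T (a == b) → a ≡ b
==-sound true true _ = refl
==-sound false false _ = refl

-- Every embedding is built one value at a time, on the codes of the vertices, while only those
-- candidates are kept whose inverse maps the blue edges found so far onto edges and the blue
-- non-edges onto non-edges.
-- The list next gives the codes of the successors of the vertices on their cycles.
module Exhaustion (ns : List ℕ) (next : List ℕ) where

  open Tables ns

  -- Adjacency on bare codes, cheap to evaluate many times during the search; `Coded` certifies that
  -- it agrees with `E`.
  adjacent : ℕ → ℕ → Bool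
  adjacent u v = (entry next u ≡ᵇ v) ∨ (entry next v ≡ᵇ u)

  compatible : List (ℕ × ℕ) → ℕ → ℕ → Bool
  compatible [] k y = true
  compatible ((k′ , y′) ∷ as) k y =
    (not (y ≡ᵇ y′) ∨ (k ≡ᵇ k′)) ∧ not (adjacent k k′ ∧ adjacent y y′) ∧ compatible as k y

  consistent : List (ℕ × ℕ) → ℕ → ℕ → List ℕ → Bool
  consistent as k y r = all (λ (k′ , y′) → adjacent k k′ == adjacent (entry r y) (entry r y′)) as

  search : List ℕ → List (ℕ × ℕ) → List (List ℕ) → Bool
  search [] as [] = false
  search [] as (_ ∷ _) = true
  search (k ∷ ks) as rs = all (λ y → not (compatible as k y) ∨
    search ks ((k , y) ∷ as) (filterᵇ (consistent ((k , y) ∷ as) k y) rs)) (upTo (sum ns))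

  vertices : List V
  vertices = concatMap (λ i → map (i ,_) (allFin _)) (allFin _)

  vertices-complete : ∀ v → v ∈ vertices
  vertices-complete (i , a) = ∈-concatMap⁺ _ {allFin _} (lose (∈-allFin i) (∈-map⁺ (i ,_) (∈-allFin a)))

  -- Every branch either dies by incompatibility or ends with a surviving candidate. For the empty
  -- list of candidates all branches must die, which is non-embeddability.
  Searched : List (List ℕ) → Set
  Searched rs = search (upTo (sum ns)) [] rs ≡ true

  Coded : Set
  Coded = (∀ u v → adjacent (code ns u) (code ns v) ≡ does (union? ns u v))
        × (∀ u v → code ns u ≡ code ns v → u ≡ v)
        × (∀ v → code ns v < sum ns)
        × map (code ns) vertices ≡ upTo (sum ns)

  coded? : Dec Coded
  coded? = (∀? λ u → ∀? λ v → adjacent (code ns u) (code ns v) ≟ᵇ does (union? ns u v))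
    ×-dec (∀? λ u → ∀? λ v → (code ns u ≟ℕ code ns v) →-dec vertex-≟ ns u v)
    ×-dec (∀? λ v → code ns v <? sum ns)
    ×-dec ≡-dec _≟ℕ_ (map (code ns) vertices) (upTo (sum ns))

  module _ (coded : Coded) (σ : Perm V) (σ-embedding : IsEmbedding E σ) where

    private
      code-injective = proj₁ (proj₂ coded)

    adjacent-complete : ∀ {u v} → E u v → adjacent (code ns u) (code ns v) ≡ true
    adjacent-complete {u} {v} e with union? ns u v | proj₁ coded u v
    ... | yes _ | eq = eq
    ... | no ¬e | _ = contradiction e ¬e

    adjacent-sound : ∀ {u v} → adjacent (code ns u) (code ns v) ≡ true → E u v
    adjacent-sound {u} {v} t with union? ns u v | proj₁ coded u v
    ... | yes e | _ = e
    ... | no _ | eq with () ← trans (sym t) eq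

    graph-of : V → ℕ × ℕ
    graph-of v = code ns v , code ns (to σ v)

    Agrees : List ℕ → V → V → Set
    Agrees r u v = adjacent (code ns u) (code ns v) ≡
      adjacent (entry r (code ns (to σ u))) (entry r (code ns (to σ v)))

    agrees-sym : ∀ {r u v} → Agrees r u v → Agrees r v u
    agrees-sym {r} {u} {v} e = trans (∨-comm (entry next (code ns v) ≡ᵇ code ns u) _)
      (trans e (∨-comm (entry next (entry r (code ns (to σ u))) ≡ᵇ _) _))

    compatible-σ : ∀ u xs → T (compatible (map graph-of xs) (code ns u) (code ns (to σ u)))
    compatible-σ u [] = tt
    compatible-σ u (v ∷ xs) = Equivalence.from T-∧ (injective , Equivalence.from T-∧ (edges , compatible-σ u xs))
      where
      injective : T (not (code ns (to σ u) ≡ᵇ code ns (to σ v)) ∨ (code ns u ≡ᵇ code ns v))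
      injective with code ns (to σ u) ≡ᵇ code ns (to σ v) in eq
      ... | false = tt
      ... | true = ℕₚ.≡⇒≡ᵇ _ _ (cong (code ns) (trans (sym (strictlyInverseʳ σ u)) (trans (cong (from σ)
              (code-injective _ _ (ℕₚ.≡ᵇ⇒≡ _ _ (subst T (sym eq) tt)))) (strictlyInverseʳ σ v))))
      edges : T (not (adjacent (code ns u) (code ns v) ∧ adjacent (code ns (to σ u)) (code ns (to σ v))))
      edges with adjacent (code ns u) (code ns v) in eq | adjacent (code ns (to σ u)) (code ns (to σ v)) in eq′
      ... | false | _ = tt
      ... | true | false = tt
      ... | true | true = σ-embedding _ _ (adjacent-sound eq) (adjacent-sound eq′)

    -- The search is replayed along the branch that σ itself describes: `compatible-σ` shows that
    -- this branch is never cut off, so a candidate survives at its end.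
    search-sound : ∀ us xs rs → T (search (map (code ns) us) (map graph-of xs) rs) →
      (∀ {r u v} → r ∈ rs → u ∈ xs → v ∈ xs → Agrees r u v) →
      ∃ λ r → r ∈ rs × (∀ {u v} → u ∈ us ⊎ u ∈ xs → v ∈ us ⊎ v ∈ xs → Agrees r u v)
    search-sound [] xs (r ∷ rs) _ agree =
      r , here refl , λ { (inj₂ p) (inj₂ q) → agree (here refl) p q }
    search-sound (w ∷ us) xs rs t agree
      with Equivalence.to T-∨ (All.lookup (Allₚ.all⁺ _ (upTo (sum ns)) t)
             (∈-upTo⁺ (proj₁ (proj₂ (proj₂ coded)) (to σ w))))
    ... | inj₁ ¬c with () ← trans (sym (Equivalence.to T-≡ (compatible-σ w xs))) (Equivalence.to T-not-≡ ¬c)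
    ... | inj₂ t′ with search-sound us (w ∷ xs) _ t′ agree′
      where
      kept : ∀ {r u} → T (consistent (graph-of w ∷ map graph-of xs) (code ns w) (code ns (to σ w)) r) →
        u ∈ w ∷ xs → Agrees r w u
      kept {r} {u} c p = ==-sound _ _ (All.lookup (Allₚ.all⁺ _ (map graph-of (w ∷ xs)) c) (∈-map⁺ graph-of p))
      agree′ : ∀ {r u v} →
        r ∈ filterᵇ (consistent (graph-of w ∷ map graph-of xs) (code ns w) (code ns (to σ w))) rs →
        u ∈ w ∷ xs → v ∈ w ∷ xs → Agrees r u v
      agree′ {r} r∈ u∈ v∈ with ∈-filter⁻ (λ _ → T? _) {xs = rs} r∈
      agree′ {r} r∈ (here refl) v∈ | _ , c = kept {r} c v∈
      agree′ {r} {u} r∈ (there u∈) (here refl) | _ , c = agrees-sym {r} {w} {u} (kept {r} c (there u∈))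
      agree′ {r} r∈ (there u∈) (there v∈) | r∈rs , _ = agree r∈rs u∈ v∈
    ...   | r , r∈ , all =
      r , proj₁ (∈-filter⁻ (λ _ → T? _) {xs = rs} r∈) , λ p q → all (relocate p) (relocate q)
      where
      relocate : ∀ {u} → u ∈ w ∷ us ⊎ u ∈ xs → u ∈ us ⊎ u ∈ w ∷ xs
      relocate (inj₁ (here e)) = inj₂ (here e)
      relocate (inj₁ (there p)) = inj₁ p
      relocate (inj₂ p) = inj₂ (there p)

    found : ∀ {rs} → Searched rs → ∃ λ r → r ∈ rs × (∀ u v → Agrees r u v)
    found t with r , r∈ , agree ← search-sound vertices [] _
        (subst (λ ks → T (search ks [] _)) (sym (proj₂ (proj₂ (proj₂ coded)))) (Equivalence.from T-≡ t)) (λ _ ()) =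
      r , r∈ , λ u v → agree (inj₁ (vertices-complete u)) (inj₁ (vertices-complete v))

  notEmbeddable : Coded → Searched [] → ¬ Embeddable E
  notEmbeddable coded t (σ , emb) with () ← proj₁ (proj₂ (found coded σ emb t))

  -- r tabulates the inverse of α ∘ σ₀ for an automorphism α.
  Candidate : Perm V → List ℕ → Set
  Candidate σ₀ r = Σ (IsTable r) λ p →
    (∀ v → code ns (relabel ns (entry r) v) ≡ entry r (code ns v))
    × (∀ u v → E u v → E (from (perm r p) (from σ₀ u)) (from (perm r p) (from σ₀ v)))
    × (∀ u v → E u v → E (to σ₀ (to (perm r p) u)) (to σ₀ (to (perm r p) v)))

  candidate? : ∀ σ₀ r → Dec (Candidate σ₀ r)
  candidate? σ₀ r with isTable? r
  ... | no n = no (n ∘ proj₁)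
  ... | yes p = map′ (p ,_) proj₂
    ((∀? λ v → code ns (relabel ns (entry r) v) ≟ℕ entry r (code ns v))
    ×-dec (∀? λ u → ∀? λ v → union? ns u v →-dec
             union? ns (relabel ns (position r) (from σ₀ u)) (relabel ns (position r) (from σ₀ v)))
    ×-dec (∀? λ u → ∀? λ v → union? ns u v →-dec
             union? ns (to σ₀ (relabel ns (entry r) u)) (to σ₀ (relabel ns (entry r) v))))

  -- Agreement with r means that σ and α ∘ σ₀ have the same image of `E`. The automorphism α fixes
  -- the red copy and carries the blue copy of σ₀ onto that of σ.
  oplus-unique : Coded → (σ₀ : Perm V) → ∀ {rs} → All (Candidate σ₀) rs → Searched rs →
    ∀ σ → IsEmbedding E σ → Oplus E σ₀ ≅ Oplus E σ
  oplus-unique coded σ₀ {rs} candidates t σ emb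
    with r , r∈ , agree ← found coded σ emb {rs} t
    with p , coded-r , α , α⁻¹ ← All.lookup candidates r∈ =
    iso b [ inj₁ ∘ α _ _ , inj₂ ∘ toBlue ] [ inj₁ ∘ α⁻¹ _ _ , inj₂ ∘ fromBlue ]
    where
    ρ = ↔-sym (perm r p)
    -- Here ρ is α ∘ σ₀, so b is α.
    b = ρ ↔-∘ ↔-sym σ₀
    edge : ∀ {x y} → E (from ρ x) (from ρ y) → E (from σ x) (from σ y)
    edge {x} {y} e = adjacent-sound coded σ emb (trans (agree (from σ x) (from σ y)) (trans
      (cong₂ adjacent (entry-from x) (entry-from y)) (adjacent-complete coded σ emb e)))
      where
      entry-from : ∀ z → entry r (code ns (to σ (from σ z))) ≡ code ns (from ρ z)
      entry-from z = trans (cong (entry r ∘ code ns) (strictlyInverseˡ σ z)) (sym (coded-r z))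
    toBlue : ∀ {u v} → E (from σ₀ u) (from σ₀ v) → E (from σ (to b u)) (from σ (to b v))
    toBlue e = edge (subst₂ E (sym (strictlyInverseʳ ρ _)) (sym (strictlyInverseʳ ρ _)) e)
    fromBlue : ∀ {x y} → E (from σ x) (from σ y) → E (from σ₀ (from b x)) (from σ₀ (from b y))
    fromBlue {x} {y} e = subst₂ E (sym (strictlyInverseʳ σ₀ _)) (sym (strictlyInverseʳ σ₀ _))
      (adjacent-sound coded σ emb (trans (cong₂ adjacent (entry-σ x) (entry-σ y))
        (trans (sym (agree (from σ x) (from σ y))) (adjacent-complete coded σ emb e))))
      where
      entry-σ : ∀ z → code ns (from ρ z) ≡ entry r (code ns (to σ (from σ z)))
      entry-σ z = trans (coded-r z) (cong (entry r ∘ code ns) (sym (strictlyInverseˡ σ z)))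

  uniquelyEmbeddable : Coded → ∀ t₀ (valid : Valid t₀) {rs} →
    All (Candidate (tablePerm t₀ valid)) rs → Searched rs → UniquelyEmbeddable E
  uniquelyEmbeddable coded t₀ valid {rs} candidates t =
    (tablePerm t₀ valid , proj₂ valid) , λ σ τ σ-emb τ-emb →
    toIso (≅-trans (≅-sym (standard σ σ-emb)) (standard τ τ-emb))
    where
    standard : ∀ σ → IsEmbedding E σ → Oplus E (tablePerm t₀ valid) ≅ Oplus E σ
    standard = oplus-unique coded (tablePerm t₀ valid) {rs} candidates t

-- Automorphisms of cycles, and the graphs settled by search

rotations : List ℕ → List (List ℕ)
rotations xs = map (λ n → drop n xs ++ take n xs) (upTo (length xs))

dihedral : List ℕ → List (List ℕ)
dihedral xs = rotations xs ++ map reverse (rotations xs)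

-- For t₀ tabulating σ₀ and t tabulating an automorphism α, this is the table of the inverse of α ∘
-- σ₀, the form in which candidates are compared.
inverses : List ℕ → List (List ℕ) → List (List ℕ)
inverses t₀ ts = map (λ t → map (position t₀ ∘ position t) (upTo (length t₀))) ts

notEmbeddable-3 : ¬ Embeddable (CycUnion (3 ∷ []))
notEmbeddable-3 = notEmbeddable (holds coded? refl) refl
  where open Exhaustion (3 ∷ []) (1 ∷ 2 ∷ 0 ∷ [])

notEmbeddable-4 : ¬ Embeddable (CycUnion (4 ∷ []))
notEmbeddable-4 = notEmbeddable (holds coded? refl) refl
  where open Exhaustion (4 ∷ []) (1 ∷ 2 ∷ 3 ∷ 0 ∷ [])

notEmbeddable-3-3 : ¬ Embeddable (CycUnion (3 ∷ 3 ∷ []))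
notEmbeddable-3-3 = notEmbeddable (holds coded? refl) refl
  where open Exhaustion (3 ∷ 3 ∷ []) (1 ∷ 2 ∷ 0 ∷ 4 ∷ 5 ∷ 3 ∷ [])

uniquelyEmbeddable-5 : UniquelyEmbeddable (CycUnion (5 ∷ []))
uniquelyEmbeddable-5 = uniquelyEmbeddable (holds coded? refl) t₀ valid {rs}
  (holds (All.all? (candidate? (tablePerm t₀ valid)) rs) refl) refl
  where
  open Tables (5 ∷ [])
  open Exhaustion (5 ∷ []) (1 ∷ 2 ∷ 3 ∷ 4 ∷ 0 ∷ [])
  t₀ : List ℕ
  t₀ = 0 ∷ 2 ∷ 4 ∷ 1 ∷ 3 ∷ []
  rs : List (List ℕ)
  -- The identity suffices: the blue copy is always the whole complement of C₅.
  rs = inverses t₀ ((0 ∷ 1 ∷ 2 ∷ 3 ∷ 4 ∷ []) ∷ [])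
  valid : Valid t₀
  valid = holds (valid? t₀) refl

uniquelyEmbeddable-6 : UniquelyEmbeddable (CycUnion (6 ∷ []))
uniquelyEmbeddable-6 = uniquelyEmbeddable (holds coded? refl) t₀ valid {rs}
  (holds (All.all? (candidate? (tablePerm t₀ valid)) rs) refl) refl
  where
  open Tables (6 ∷ [])
  open Exhaustion (6 ∷ []) (1 ∷ 2 ∷ 3 ∷ 4 ∷ 5 ∷ 0 ∷ [])
  t₀ : List ℕ
  t₀ = 4 ∷ 1 ∷ 5 ∷ 3 ∷ 0 ∷ 2 ∷ []
  rs : List (List ℕ)
  -- The complement of C₆ is a prism. It has three Hamiltonian cycles, one for each omitted edge of
  -- the matching, and three rotations reach them all.
  rs = inverses t₀ (take 3 (rotations (0 ∷ 1 ∷ 2 ∷ 3 ∷ 4 ∷ 5 ∷ [])))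
  valid : Valid t₀
  valid = holds (valid? t₀) refl

uniquelyEmbeddable-3-4 : UniquelyEmbeddable (CycUnion (3 ∷ 4 ∷ []))
uniquelyEmbeddable-3-4 = uniquelyEmbeddable (holds coded? refl) t₀ valid {rs}
  (holds (All.all? (candidate? (tablePerm t₀ valid)) rs) refl) refl
  where
  open Tables (3 ∷ 4 ∷ [])
  open Exhaustion (3 ∷ 4 ∷ []) (1 ∷ 2 ∷ 0 ∷ 4 ∷ 5 ∷ 6 ∷ 3 ∷ [])
  t₀ : List ℕ
  t₀ = 3 ∷ 2 ∷ 5 ∷ 6 ∷ 1 ∷ 4 ∷ 0 ∷ []
  rs : List (List ℕ)
  -- The blue triangle consists of a vertex of C₃ and a diagonal of C₄, three times two choices; the
  -- blue C₄ is then forced.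
  rs = inverses t₀ (cartesianProductWith _++_ (rotations (0 ∷ 1 ∷ 2 ∷ []))
    (take 2 (rotations (3 ∷ 4 ∷ 5 ∷ 6 ∷ []))))
  valid : Valid t₀
  valid = holds (valid? t₀) refl

uniquelyEmbeddable-3-5 : UniquelyEmbeddable (CycUnion (3 ∷ 5 ∷ []))
uniquelyEmbeddable-3-5 = uniquelyEmbeddable (holds coded? refl) t₀ valid {rs}
  (holds (All.all? (candidate? (tablePerm t₀ valid)) rs) refl) refl
  where
  open Tables (3 ∷ 5 ∷ [])
  open Exhaustion (3 ∷ 5 ∷ []) (1 ∷ 2 ∷ 0 ∷ 4 ∷ 5 ∷ 6 ∷ 7 ∷ 3 ∷ [])
  t₀ : List ℕ
  t₀ = 3 ∷ 0 ∷ 5 ∷ 6 ∷ 1 ∷ 7 ∷ 2 ∷ 4 ∷ []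
  rs : List (List ℕ)
  -- The full automorphism group of C₃ ∪ C₅, of order sixty.
  rs = inverses t₀ (cartesianProductWith _++_ (dihedral (0 ∷ 1 ∷ 2 ∷ []))
    (dihedral (3 ∷ 4 ∷ 5 ∷ 6 ∷ 7 ∷ [])))
  valid : Valid t₀
  valid = holds (valid? t₀) refl

-- Unions of three and of four triangles

injective⇒surjective : ∀ {m n} → m ≡ n → (f : Fin m → Fin n) → (∀ {x y} → f x ≡ f y → x ≡ y) →
  ∀ y → ∃ λ x → f x ≡ y
injective⇒surjective {suc n} refl f inj y with Finₚ.any? (λ x → f x ≟ y)
... | yes hit = hit
... | no miss = contradiction
  (Finₚ.injective⇒≤ {f = λ x → punchOut {i = y} {f x} (λ e → miss (x , sym e))}
    (λ {u} {v} e → inj (Finₚ.punchOut-injective (λ e → miss (u , sym e)) (λ e → miss (v , sym e)) e)))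
  ℕₚ.1+n≰n

injective⇒surjective-avoiding : ∀ {m n} → suc m ≡ n → (f : Fin m → Fin n) →
  (∀ {x y} → f x ≡ f y → x ≡ y) →
  ∀ {i} → (∀ x → i ≢ f x) → ∀ {y} → i ≢ y → ∃ λ x → f x ≡ y
injective⇒surjective-avoiding refl f inj avoid i≢y
  with x , e ← injective⇒surjective refl (λ x → punchOut (avoid x))
                 (λ {u} {v} e → inj (Finₚ.punchOut-injective (avoid u) (avoid v) e)) (punchOut i≢y)
  = x , Finₚ.punchOut-injective (avoid x) i≢y e

missed : ∀ {m n} → suc m ≡ n → (f : Fin m → Fin n) → ∃ λ y → ∀ x → f x ≢ y
missed {m} refl f with Finₚ.¬∀⟶∃¬ (suc m) (λ y → ∃ λ x → f x ≡ y) (λ y → Finₚ.any? λ x → f x ≟ y) notAll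
  where
  notAll : ¬ (∀ y → ∃ λ x → f x ≡ y)
  notAll s = ℕₚ.1+n≰n (Finₚ.injective⇒≤ {f = proj₁ ∘ s} λ {y} {y′} e →
    trans (sym (proj₂ (s y))) (trans (cong f e) (proj₂ (s y′))))
... | y , miss = y , λ x e → miss (x , e)

-- In a packing of triangles the position of a vertex is determined by its red triangle (its
-- row) and its blue triangle (its column).
module TriangleUnion (ns : List ℕ) (triangles : ∀ i → lookup ns i ≡ 3)
  (clique : ∀ u v → u ≢ v → proj₁ u ≡ proj₁ v → CycUnion ns u v)
  (irreflexive : Irreflexive (CycUnion ns)) where

  V = CVert ns
  E = CycUnion ns
  K = Fin (length ns)

  row : V → K
  row = proj₁

  inRow : K → Fin 3 → V
  inRow i a = i , subst Fin (sym (triangles i)) a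

  inRow-injective : ∀ i {a b} → inRow i a ≡ inRow i b → a ≡ b
  inRow-injective i e = subst-injective (sym (triangles i)) (,-injectiveʳ e)

  inRow-surjective : ∀ v → ∃ λ a → inRow (row v) a ≡ v
  inRow-surjective (i , a) = subst Fin (triangles i) a , cong (i ,_) (subst-sym-subst (triangles i))

  module Columns (σ : Perm V) (emb : IsEmbedding E σ) where

    column : V → K
    column v = row (from σ v)

    from-≢ : ∀ {u v} → u ≢ v → from σ u ≢ from σ v
    from-≢ u≢v e = u≢v (trans (sym (strictlyInverseˡ σ _)) (trans (cong (to σ) e) (strictlyInverseˡ σ _)))

    -- Distinct vertices sharing both triangles would be joined by a red and by a blue edge.
    position-determines : ∀ {u v} → row u ≡ row v → column u ≡ column v → u ≡ v
    position-determines {u} {v} r c with vertex-≟ ns u v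
    ... | yes e = e
    ... | no u≢v = contradiction
      (subst₂ E (sym (strictlyInverseˡ σ u)) (sym (strictlyInverseˡ σ v)) (clique u v u≢v r))
      (emb _ _ (clique _ _ (from-≢ u≢v) c))

    columnOfRow : K → Fin 3 → K
    columnOfRow i a = column (inRow i a)

    columnOfRow-injective : ∀ i {a b} → columnOfRow i a ≡ columnOfRow i b → a ≡ b
    columnOfRow-injective i e = inRow-injective i (position-determines refl e)

    rowOfColumn : K → Fin 3 → K
    rowOfColumn j a = row (to σ (inRow j a))

    rowOfColumn-hits : ∀ v → ∃ λ a → rowOfColumn (column v) a ≡ row v
    rowOfColumn-hits v with a , e ← inRow-surjective (from σ v) =
      a , cong row (trans (cong (to σ) e) (strictlyInverseˡ σ v))

  -- A labelling n of the columns; two embeddings give isomorphic graphs as soon as the same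
  -- pairs of a row and a column label are occupied.
  record Labelled (σ : Perm V) : Set where
    field
      emb : IsEmbedding E σ
    open Columns σ emb public
    field
      n           : K → K
      n-injective : ∀ {j j′} → n j ≡ n j′ → j ≡ j′

    label : V → K
    label v = n (column v)

    label-determines : ∀ {u v} → row u ≡ row v → label u ≡ label v → u ≡ v
    label-determines r l = position-determines r (n-injective l)

  open Labelled using (from-≢; n; n-injective; label; label-determines)

  module _ {σ τ : Perm V} (L : Labelled σ) (M : Labelled τ)
    (there : ∀ v → ∃ λ w → row w ≡ row v × label M w ≡ label L v)
    (back : ∀ w → ∃ λ v → row v ≡ row w × label L v ≡ label M w) where

    private
      f = proj₁ ∘ there
      g = proj₁ ∘ back

      fg : ∀ w → f (g w) ≡ w
      fg w with v , r , l ← back w with u , r′ , l′ ← there v =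
        label-determines M (trans r′ r) (trans l′ l)

      gf : ∀ v → g (f v) ≡ v
      gf v with w , r , l ← there v with u , r′ , l′ ← back w =
        label-determines L (trans r′ r) (trans l′ l)

      transfer : ∀ {σ τ : Perm V} (L : Labelled σ) (M : Labelled τ) (f : V → V) →
        (∀ {u v} → f u ≡ f v → u ≡ v) →
        (∀ v → row (f v) ≡ row v × label M (f v) ≡ label L v) →
        ∀ {u v} → Oplus E σ u v → Oplus E τ (f u) (f v)
      transfer L M f inj same {u} {v} (inj₁ e) = inj₁ (clique _ _ (λ fe → irr (inj fe) e)
        (trans (proj₁ (same u)) (trans (proj₁ e) (sym (proj₁ (same v))))))
        where
        irr : ∀ {u v} → u ≡ v → ¬ E u v
        irr refl = irreflexive _
      transfer {σ} L M f inj same {u} {v} (inj₂ e) = inj₂ (clique _ _ (from-≢ M (λ fe → irr (inj fe) e))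
        (n-injective M (trans (proj₂ (same u)) (trans (cong (n L) (proj₁ e)) (sym (proj₂ (same v)))))))
        where
        irr : ∀ {u v} → u ≡ v → ¬ E (from σ u) (from σ v)
        irr refl = irreflexive _

      injective : ∀ (h h′ : V → V) → (∀ v → h′ (h v) ≡ v) → ∀ {u v} → h u ≡ h v → u ≡ v
      injective h h′ inv e = trans (sym (inv _)) (trans (cong h′ e) (inv _))

    labelled⇒iso : Iso (Oplus E σ) (Oplus E τ)
    labelled⇒iso = toIso (iso (mk↔ₛ′ f g fg gf)
      (transfer L M f (injective f g gf) (proj₂ ∘ there))
      (transfer M L g (injective g f fg) (proj₂ ∘ back)))

  -- The three vertices of a row lie in different columns, and there are only three columns: every
  -- cell of the grid is occupied, and the graph is always K₃ □ K₃.
  three-triangles : 3 ≡ length ns → ∀ σ τ → IsEmbedding E σ → IsEmbedding E τ → Iso (Oplus E σ) (Oplus E τ)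
  three-triangles eq σ τ σ-emb τ-emb = labelled⇒iso L M (hit L M) (hit M L)
    where
    labelled : ∀ σ → IsEmbedding E σ → Labelled σ
    labelled σ emb = record { emb = emb ; n = id ; n-injective = id }
    L = labelled σ σ-emb
    M = labelled τ τ-emb
    hit : ∀ {σ τ} (L : Labelled σ) (M : Labelled τ) → ∀ v → ∃ λ w → row w ≡ row v × label M w ≡ label L v
    hit L M v with a , e ← injective⇒surjective eq (λ a → label M (inRow (row v) a))
                    (λ e → inRow-injective _ (label-determines M refl e)) (label L v) =
      _ , refl , e

  module MissedRow (eq : 4 ≡ length ns) (σ : Perm V) (emb : IsEmbedding E σ) where

    open Columns σ emb

    missedRow : K → K
    missedRow j = proj₁ (missed eq (rowOfColumn j))

    row≢missedRow : ∀ v → row v ≢ missedRow (column v)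
    row≢missedRow v e with a , h ← rowOfColumn-hits v =
      proj₂ (missed eq (rowOfColumn (column v))) a (trans h e)

    -- The three vertices of a row missed by column j occupy three different columns other than j,
    -- hence all of them, so no other column misses that row.
    missedRow-injective : ∀ {j j′} → missedRow j ≡ missedRow j′ → j ≡ j′
    missedRow-injective {j} {j′} e with j ≟ j′
    ... | yes j≡j′ = j≡j′
    ... | no j≢j′ = ⊥-elim (avoids e (proj₁ hit) (sym (proj₂ hit)))
      where
      avoids : ∀ {k} → missedRow j ≡ missedRow k → ∀ a → k ≢ columnOfRow (missedRow j) a
      avoids e a c = row≢missedRow (inRow (missedRow j) a) (trans e (cong missedRow c))
      hit : ∃ λ a → columnOfRow (missedRow j) a ≡ j′
      hit = injective⇒surjective-avoiding eq (columnOfRow (missedRow j))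
              (columnOfRow-injective (missedRow j)) (avoids refl) j≢j′

    labelled : Labelled σ
    labelled = record { emb = emb ; n = missedRow ; n-injective = missedRow-injective }

    occupied : ∀ {i l} → i ≢ l → ∃ λ w → row w ≡ i × missedRow (column w) ≡ l
    occupied {i} i≢l with a , e ← injective⇒surjective-avoiding eq (λ a → missedRow (columnOfRow i a))
                       (λ e → columnOfRow-injective i (missedRow-injective e))
                       (λ a → row≢missedRow (inRow i a)) i≢l =
      inRow i a , refl , e

  -- Each of the four columns misses one row, and it is labelled by that row: the pairs of a row
  -- and a different label are the occupied ones.
  four-triangles : 4 ≡ length ns → ∀ σ τ → IsEmbedding E σ → IsEmbedding E τ → Iso (Oplus E σ) (Oplus E τ)
  four-triangles eq σ τ σ-emb τ-emb = labelled⇒iso L.labelled M.labelled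
    (λ v → M.occupied (L.row≢missedRow v)) (λ v → L.occupied (M.row≢missedRow v))
    where
    module L = MissedRow eq σ σ-emb
    module M = MissedRow eq τ τ-emb

uniquelyEmbeddable-3-3-3 : UniquelyEmbeddable (CycUnion (3 ∷ 3 ∷ 3 ∷ []))
uniquelyEmbeddable-3-3-3 = (tablePerm t valid , proj₂ valid) ,
  TriangleUnion.three-triangles (3 ∷ 3 ∷ 3 ∷ [])
    (holds (Finₚ.all? λ i → lookup (3 ∷ 3 ∷ 3 ∷ []) i ≟ℕ 3) refl)
    (holds (∀? λ u → ∀? λ v → u ≢? v →-dec (proj₁ u ≟ proj₁ v →-dec union? _ u v)) refl)
    (union-irreflexive (3≤3+n ∷ 3≤3+n ∷ 3≤3+n ∷ [])) refl
  where
  open Tables (3 ∷ 3 ∷ 3 ∷ [])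
  t : List ℕ
  t = 4 ∷ 1 ∷ 7 ∷ 2 ∷ 5 ∷ 8 ∷ 3 ∷ 0 ∷ 6 ∷ []
  valid : Valid t
  valid = holds (valid? t) refl

uniquelyEmbeddable-3-3-3-3 : UniquelyEmbeddable (CycUnion (3 ∷ 3 ∷ 3 ∷ 3 ∷ []))
uniquelyEmbeddable-3-3-3-3 = (tablePerm t valid , proj₂ valid) ,
  TriangleUnion.four-triangles (3 ∷ 3 ∷ 3 ∷ 3 ∷ [])
    (holds (Finₚ.all? λ i → lookup (3 ∷ 3 ∷ 3 ∷ 3 ∷ []) i ≟ℕ 3) refl)
    (holds (∀? λ u → ∀? λ v → u ≢? v →-dec (proj₁ u ≟ proj₁ v →-dec union? _ u v)) refl)
    (union-irreflexive (3≤3+n ∷ 3≤3+n ∷ 3≤3+n ∷ 3≤3+n ∷ [])) refl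
  where
  open Tables (3 ∷ 3 ∷ 3 ∷ 3 ∷ [])
  t : List ℕ
  t = 2 ∷ 11 ∷ 3 ∷ 6 ∷ 0 ∷ 9 ∷ 7 ∷ 1 ∷ 4 ∷ 5 ∷ 8 ∷ 10 ∷ []
  valid : Valid t
  valid = holds (valid? t) refl

-- Classification

good-↭ : ∀ {ms ns} → ms ↭ ns → Good (CycUnion ms) → Good (CycUnion ns)
good-↭ p = good-≅ (union-↭ p)

good-∷ : ∀ {n ns} → 3 ≤ n → Good (CycUnion ns) → Good (CycUnion (n ∷ ns))
good-∷ {n} {ns} 3≤n g = good-≅ (≅-sym (union-∷ n ns)) (add-cycle (vertex-≟ ns) 3≤n g)

good-++ : ∀ {ms} ns → All (3 ≤_) ms → Good (CycUnion ns) → Good (CycUnion (ms ++ ns))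
good-++ ns [] g = g
good-++ ns (_∷_ {xs = ms} 3≤m 3≤ms) g = good-∷ {ns = ms ++ ns} 3≤m (good-++ ns 3≤ms g)

all-replicate : ∀ t {n} → 3 ≤ n → All (3 ≤_) (replicate t n)
all-replicate zero _ = []
all-replicate (suc t) 3≤n = 3≤n ∷ all-replicate t 3≤n

threes fours : ℕ → List ℕ
threes t = replicate t 3
fours f = replicate f 4

all-threes : ∀ t → All (3 ≤_) (threes t)
all-threes t = all-replicate t 3≤3+n

good-threes : ∀ t → Good (CycUnion (threes (3 + t)))
good-threes zero = good-3-3-3
good-threes (suc t) = good-∷ {ns = threes (3 + t)} 3≤3+n (good-threes t)

good-threes-4 : ∀ t → Good (CycUnion (threes (1 + t) ++ 4 ∷ []))
good-threes-4 zero = good-3-4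
good-threes-4 (suc t) = good-∷ {ns = threes (1 + t) ++ 4 ∷ []} 3≤3+n (good-threes-4 t)

good-fours : ∀ f → Good (CycUnion (fours (2 + f)))
good-fours zero = good-4-4
good-fours (suc f) = good-∷ {ns = fours (2 + f)} 3≤3+n (good-fours f)

good-threes-fours : ∀ t f → Good (CycUnion (threes t ++ fours (2 + f)))
good-threes-fours t f = good-++ (fours (2 + f)) (all-threes t) (good-fours f)

good-single : ∀ k → Good (CycUnion (6 + k ∷ []))
good-single k = subst (λ b → Good (CycUnion (3 + b ∷ []))) (ℕₚ.+-comm k 3) (good-6+ k)

packing-single : ∀ b → Packing (CycUnion (5 + b ∷ []))
packing-single zero = packing-5
packing-single (suc k) = Good.packing (good-single k)

-- A triangle has nothing to exchange with in K₅, so C₃ ∪ C₅ comes from a table; a longer partner is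
-- grown beside the pentagon.
good-pentagon : ∀ {m} → 3 ≤ m → Good (CycUnion (m ∷ 5 ∷ []))
good-pentagon {3} _ = good-3-5
good-pentagon {suc (suc (suc (suc k)))} _ =
  subst (λ m → Good (CycUnion (3 + m ∷ 5 ∷ []))) (ℕₚ.+-comm k 1)
    (good-≅ (≅-sym (union-∷ _ (5 ∷ [])))
      (add-long-cycle (vertex-≟ (5 ∷ [])) packing-5 connected-5 {x = zero , zero} {y = zero , suc zero} (λ ()) k))
good-pentagon {1} (s≤s ())
good-pentagon {2} (s≤s (s≤s ()))

-- From length six on the long cycle is a `Good` start by itself; C₅ becomes one only together with
-- a second cycle, hence the separate m.
good-long : ∀ b {m ms} → All (3 ≤_) (m ∷ ms) → Good (CycUnion (5 + b ∷ m ∷ ms))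
good-long zero {m} {ms} (3≤m ∷ 3≤ms) =
  good-↭ (↭-trans (++-comm ms (m ∷ 5 ∷ [])) (swap m 5 refl)) (good-++ (m ∷ 5 ∷ []) 3≤ms (good-pentagon 3≤m))
good-long (suc k) {m} {ms} 3≤ms =
  good-↭ (++-comm (m ∷ ms) (6 + k ∷ [])) (good-++ (6 + k ∷ []) 3≤ms (good-single k))

packing-long : ∀ b {ms} → All (3 ≤_) ms → Packing (CycUnion (5 + b ∷ ms))
packing-long b [] = packing-single b
packing-long b (3≤m ∷ 3≤ms) = Good.packing (good-long b (3≤m ∷ 3≤ms))

vertex : ∀ ns → Good (CycUnion ns) → CVert ns
vertex ns (good p _ pair) = from (bij (red p)) (NonAdjacentPair.x pair)

twoDistinct-↭ : ∀ {ms ns} → ms ↭ ns → TwoDistinctEmbeddings (CycUnion ms) → TwoDistinctEmbeddings (CycUnion ns)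
twoDistinct-↭ p = twoDistinct-≅ (union-↭ p)

-- One embedding is connected and the other one keeps the two parts apart.
split : ∀ ms ns → Good (CycUnion (ms ++ ns)) → Packing (CycUnion ms) → CVert ms →
  Packing (CycUnion ns) → CVert ns → TwoDistinctEmbeddings (CycUnion (ms ++ ns))
split ms ns (good p c _) q u r v =
  twoDistinct Connected connected-invariant p (packing-≅ (≅-sym (union-++ ms ns)) (q ⊎-packing r)) c
    (⊎-packing-disconnected q r u v)

splitGood : ∀ ms ns → All (3 ≤_) ms → Good (CycUnion ms) → Good (CycUnion ns) →
  TwoDistinctEmbeddings (CycUnion (ms ++ ns))
splitGood ms ns 3≤ms g h =
  split ms ns (good-++ ns 3≤ms h) (Good.packing g) (vertex ms g) (Good.packing h) (vertex ns h)

splitSingle : ∀ b ns → Good (CycUnion ns) → TwoDistinctEmbeddings (CycUnion (5 + b ∷ ns))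
splitSingle b ns h =
  split (5 + b ∷ []) ns (good-∷ {ns = ns} 3≤3+n h) (packing-single b) (zero , zero) (Good.packing h) (vertex ns h)

NotEmbeddableType UniqueType : List ℕ → Set
NotEmbeddableType ns = ns ↭ (3 ∷ []) ⊎ ns ↭ (4 ∷ []) ⊎ ns ↭ (3 ∷ 3 ∷ [])
UniqueType ns = ns ↭ (5 ∷ []) ⊎ ns ↭ (6 ∷ []) ⊎ ns ↭ (3 ∷ 4 ∷ []) ⊎ ns ↭ (3 ∷ 5 ∷ [])
  ⊎ ns ↭ (3 ∷ 3 ∷ 3 ∷ []) ⊎ ns ↭ (3 ∷ 3 ∷ 3 ∷ 3 ∷ [])

data Outcome (ns : List ℕ) : Set where
  none : NotEmbeddableType ns → Outcome ns
  one  : UniqueType ns → Outcome ns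
  two  : TwoDistinctEmbeddings (CycUnion ns) → Outcome ns

family : ∀ n ms → (∀ k → TwoDistinctEmbeddings (CycUnion (3 + (k + n) ∷ ms))) →
  ∀ k → TwoDistinctEmbeddings (CycUnion (3 + (n + k) ∷ ms))
family n ms grown k = subst (λ b → TwoDistinctEmbeddings (CycUnion (3 + b ∷ ms))) (ℕₚ.+-comm k n) (grown k)

outcome-↭ : ∀ {ms ns} → ms ↭ ns → Outcome ms → Outcome ns
outcome-↭ p (none x) = none (map-⊎ q (map-⊎ q q) x)
  where
  q : ∀ {ks} → _ ↭ ks → _ ↭ ks
  q = ↭-trans (↭-sym p)
outcome-↭ p (one x) = one (map-⊎ q (map-⊎ q (map-⊎ q (map-⊎ q (map-⊎ q q)))) x)
  where
  q : ∀ {ks} → _ ↭ ks → _ ↭ ks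
  q = ↭-trans (↭-sym p)
outcome-↭ p (two x) = two (twoDistinct-↭ p x)

-- Outcomes by the numbers of triangles, four-cycles and longer cycles

outcome-threes : ∀ t → Outcome (threes (1 + t))
outcome-threes 0 = none (inj₁ refl)
outcome-threes 1 = none (inj₂ (inj₂ refl))
outcome-threes 2 = one (inj₂ (inj₂ (inj₂ (inj₂ (inj₁ refl)))))
outcome-threes 3 = one (inj₂ (inj₂ (inj₂ (inj₂ (inj₂ refl)))))
outcome-threes 4 = two twoDistinct-3-3-3-3-3
-- At least six triangles: three of them, and at least three others.
outcome-threes (suc (suc (suc (suc (suc t))))) =
  two (splitGood (threes 3) (threes (3 + t)) (all-threes 3) good-3-3-3 (good-threes t))

-- A part of triangles and four-cycles is available as `Good` if it has three triangles, or one of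
-- each length, or two four-cycles. Wherever two such parts can be formed the graph splits; the
-- other shapes are exceptions, tables or the start of a family.
outcome-threes-fours : ∀ t f → Outcome (threes t ++ fours (1 + f))
outcome-threes-fours 0 0 = none (inj₂ (inj₁ refl))
outcome-threes-fours 1 0 = one (inj₂ (inj₂ (inj₁ refl)))
outcome-threes-fours 2 0 = two (twoDistinct-↭ (++-comm (4 ∷ []) (threes 2)) twoDistinct-4-3-3)
outcome-threes-fours 3 0 = two twoDistinct-3-3-3-4
outcome-threes-fours (suc (suc (suc (suc t)))) 0 =
  two (splitGood (threes 3) (threes (1 + t) ++ 4 ∷ []) (all-threes 3) good-3-3-3 (good-threes-4 t))
outcome-threes-fours 0 1 = two (family 1 (4 ∷ []) twoDistinct-4-4+ 0)
outcome-threes-fours 1 1 = two twoDistinct-3-4-4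
outcome-threes-fours (suc (suc t)) 1 = two (twoDistinct-↭ (prep 3 (↭-sym (shift 4 (threes (1 + t)) (fours 1))))
  (splitGood (3 ∷ 4 ∷ []) (threes (1 + t) ++ 4 ∷ []) (3≤3+n ∷ 3≤3+n ∷ []) good-3-4 (good-threes-4 t)))
outcome-threes-fours 0 2 = two twoDistinct-4-4-4
outcome-threes-fours (suc t) 2 = two (twoDistinct-↭ (prep 3 (↭-sym (shift 4 (threes t) (fours 2))))
  (splitGood (3 ∷ 4 ∷ []) (threes t ++ fours 2) (3≤3+n ∷ 3≤3+n ∷ []) good-3-4 (good-threes-fours t 0)))
outcome-threes-fours t (suc (suc (suc f))) = two (twoDistinct-↭
  (↭-trans (prep 4 (↭-sym (shift 4 (threes t) (fours (2 + f))))) (↭-sym (shift 4 (threes t) (fours (3 + f)))))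
  (splitGood (4 ∷ 4 ∷ []) (threes t ++ fours (2 + f)) (3≤3+n ∷ 3≤3+n ∷ []) good-4-4 (good-threes-fours t f)))

outcome-threes-long : ∀ t b → Outcome (5 + b ∷ threes t)
outcome-threes-long 0 0 = one (inj₁ refl)
outcome-threes-long 0 1 = one (inj₂ (inj₁ refl))
outcome-threes-long 0 2 = two twoDistinct-7
outcome-threes-long 0 (suc (suc (suc k))) = two (family 5 [] twoDistinct-8+ k)
outcome-threes-long 1 0 = one (inj₂ (inj₂ (inj₂ (inj₁ (swap 5 3 refl)))))
outcome-threes-long 1 1 = two twoDistinct-6-3
outcome-threes-long 1 (suc (suc k)) = two (family 4 (3 ∷ []) twoDistinct-7-3+ k)
outcome-threes-long 2 0 = two twoDistinct-5-3-3
outcome-threes-long 2 (suc k) = two (family 3 (3 ∷ 3 ∷ []) twoDistinct-6-3-3+ k)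
outcome-threes-long (suc (suc (suc t))) b = two (splitSingle b (threes (3 + t)) (good-threes t))

outcome-threes-fours-long : ∀ t f b → Outcome (5 + b ∷ threes t ++ fours (1 + f))
-- The family starts at C₄ ∪ C₄, so a first cycle of length 5 + b is reached after 1 + b steps.
outcome-threes-fours-long 0 0 b = two (family 1 (4 ∷ []) twoDistinct-4-4+ (1 + b))
outcome-threes-fours-long (suc t) 0 b = two (splitSingle b (threes (1 + t) ++ 4 ∷ []) (good-threes-4 t))
outcome-threes-fours-long t (suc f) b = two (splitSingle b (threes t ++ fours (2 + f)) (good-threes-fours t f))

outcome-long-long : ∀ b b′ {ns} → All (3 ≤_) ns → Outcome (5 + b ∷ 5 + b′ ∷ ns)
outcome-long-long b b′ 3≤ns = two (split (5 + b ∷ []) (5 + b′ ∷ _) (good-long b (3≤3+n ∷ 3≤ns))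
  (packing-single b) (zero , zero) (packing-long b′ 3≤ns) (zero , zero))

record Sorted (ns : List ℕ) : Set where
  constructor sorted
  field
    #threes #fours : ℕ
    -- The excess over five of each longer cycle.
    longs : List ℕ
    ↭-sorted : ns ↭ map (5 +_) longs ++ (threes #threes ++ fours #fours)

insert : ∀ n {ns} → 3 ≤ n → Sorted ns → Sorted (n ∷ ns)
insert 1 (s≤s ())
insert 2 (s≤s (s≤s ()))
insert 3 _ (sorted t f bs p) = sorted (1 + t) f bs
  (↭-trans (prep 3 p) (↭-sym (shift 3 (map (5 +_) bs) (threes t ++ fours f))))
insert 4 _ (sorted t f bs p) = sorted t (1 + f) bs
  (↭-trans (prep 4 p) (↭-trans (↭-sym (shift 4 (map (5 +_) bs) (threes t ++ fours f)))
    (++⁺ˡ (map (5 +_) bs) (↭-sym (shift 4 (threes t) (fours f))))))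
insert (suc (suc (suc (suc (suc b))))) _ (sorted t f bs p) = sorted t f (b ∷ bs) (prep (5 + b) p)

sort : ∀ {ns} → All (3 ≤_) ns → Sorted ns
sort [] = sorted 0 0 [] refl
sort (3≤n ∷ 3≤ns) = insert _ 3≤n (sort 3≤ns)

outcome : ∀ {ns} → 1 ≤ length ns → All (3 ≤_) ns → Outcome ns
outcome {ns} 1≤ 3≤ns with sort 3≤ns
... | sorted t f bs p = outcome-↭ (↭-sym p) (by-shape t f bs (subst (1 ≤_) (↭-length p) 1≤))
  where
  by-shape : ∀ t f bs → 1 ≤ length (map (5 +_) bs ++ (threes t ++ fours f)) →
    Outcome (map (5 +_) bs ++ (threes t ++ fours f))
  by-shape zero zero [] ()
  by-shape (suc t) zero [] _ = subst Outcome (sym (++-identityʳ _)) (outcome-threes t)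
  by-shape t (suc f) [] _ = outcome-threes-fours t f
  by-shape t zero (b ∷ []) _ =
    subst (λ ns → Outcome (5 + b ∷ ns)) (sym (++-identityʳ _)) (outcome-threes-long t b)
  by-shape t (suc f) (b ∷ []) _ = outcome-threes-fours-long t f b
  by-shape t f (b ∷ b′ ∷ bs) _ = outcome-long-long b b′
    (Allₚ.++⁺ (Allₚ.map⁺ (All.universal (λ _ → 3≤3+n) bs))
      (Allₚ.++⁺ (all-threes t) (all-replicate f 3≤3+n)))

theorem5 : (ns : List ℕ) → 1 ≤ length ns → All (3 ≤_) ns →
    ((ns ↭ (3 ∷ []) ⊎ ns ↭ (4 ∷ []) ⊎ ns ↭ (3 ∷ 3 ∷ [])) →
    ¬ Embeddable (CycUnion ns))
    × ((ns ↭ (5 ∷ []) ⊎ ns ↭ (6 ∷ []) ⊎ ns ↭ (3 ∷ 4 ∷ []) ⊎ ns ↭ (3 ∷ 5 ∷ [])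
    ⊎ ns ↭ (3 ∷ 3 ∷ 3 ∷ []) ⊎ ns ↭ (3 ∷ 3 ∷ 3 ∷ 3 ∷ [])) →
    UniquelyEmbeddable (CycUnion ns))
    × (¬ (ns ↭ (3 ∷ []) ⊎ ns ↭ (4 ∷ []) ⊎ ns ↭ (3 ∷ 3 ∷ [])) →
    ¬ (ns ↭ (5 ∷ []) ⊎ ns ↭ (6 ∷ []) ⊎ ns ↭ (3 ∷ 4 ∷ []) ⊎ ns ↭ (3 ∷ 5 ∷ [])
    ⊎ ns ↭ (3 ∷ 3 ∷ 3 ∷ []) ⊎ ns ↭ (3 ∷ 3 ∷ 3 ∷ 3 ∷ [])) →
    TwoDistinctEmbeddings (CycUnion ns))
theorem5 ns 1≤ 3≤ns =
  [ notEmb (3 ∷ []) notEmbeddable-3 , [ notEmb (4 ∷ []) notEmbeddable-4 , notEmb (3 ∷ 3 ∷ []) notEmbeddable-3-3 ] ] ,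
  [ unique (5 ∷ []) uniquelyEmbeddable-5 , [ unique (6 ∷ []) uniquelyEmbeddable-6 ,
  [ unique (3 ∷ 4 ∷ []) uniquelyEmbeddable-3-4 , [ unique (3 ∷ 5 ∷ []) uniquelyEmbeddable-3-5 ,
  [ unique (3 ∷ 3 ∷ 3 ∷ []) uniquelyEmbeddable-3-3-3 ,
    unique (3 ∷ 3 ∷ 3 ∷ 3 ∷ []) uniquelyEmbeddable-3-3-3-3 ] ] ] ] ] ,
  distinct (outcome 1≤ 3≤ns)
  where
  notEmb : ∀ ms → ¬ Embeddable (CycUnion ms) → ns ↭ ms → ¬ Embeddable (CycUnion ns)
  notEmb ms ¬e p = ¬e ∘ embeddable-≅ (union-↭ p)
  unique : ∀ ms → UniquelyEmbeddable (CycUnion ms) → ns ↭ ms → UniquelyEmbeddable (CycUnion ns)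
  unique ms u p = uniquelyEmbeddable-≅ (union-↭ (↭-sym p)) u
  distinct : Outcome ns → ¬ NotEmbeddableType ns → ¬ UniqueType ns → TwoDistinctEmbeddings (CycUnion ns)
  distinct (none x) ¬x _ = contradiction x ¬x
  distinct (one x) _ ¬x = contradiction x ¬x
  distinct (two t) _ _ = t
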